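{- For any set $\mathcal{D}\subseteq\mathbb{R}^d_{\ge0}$ (nonempty, over which every symmetric monotonic norm attains its minimum) and any $\epsilon\in(0,1]$, there is a $(1+\epsilon)$-approximate portfolio of size $\mathrm{poly}(d^{1/\epsilon})$ over $\mathcal{D}$ for the class of symmetric monotonic norms; that is, the size is bounded by a fixed polynomial (independent of $\mathcal{D}$, $d$, $\epsilon$) in $d^{1/\epsilon}$.
   Context: A symmetric monotonic norm on $\mathbb{R}^d$ is a norm invariant under permutations of coordinates and nondecreasing in each coordinate (on the nonnegative orthant). Given $\mathcal{D}\subseteq\mathbb{R}^d_{\ge0}$, a class $\mathbf{C}$ of functions $\mathcal{D}\to\mathbb{R}_{\ge 0}$ and $\alpha\ge 1$, a set $X\subseteq\mathcal{D}$ is an $\alpha$-approximate portfolio for $\mathbf{C}$ over $\mathcal{D}$ if $\min_{x\in X}f(x)\le\alpha\min_{x\in\mathcal{D}}f(x)$ for every $f\in\mathbf{C}$. -}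

module Defs where

open import Algebra.Bundles using (CommutativeRing)
import Algebra.Construct.NaturalChoice.Max as Max
import Algebra.Properties.Ring as RingProperties
import Algebra.Properties.Semiring.Exp as Exp
import Algebra.Properties.Semiring.Mult as Mult
open import Axiom.ExcludedMiddle using (ExcludedMiddle)
open import Data.Empty using (⊥-elim)
open import Data.Fin.Permutation using (Permutation′; _⟨$⟩ʳ_)
open import Data.List.Base using (List; foldr)
open import Data.Nat.Base as ℕ using (ℕ; zero; suc; NonZero)
import Data.Nat.Properties as ℕ
open import Data.Product.Base using (∃; ∃₂; _×_; _,_; proj₁; proj₂)
open import Data.Sum.Base using (inj₁; inj₂)
open import Data.Vec.Functional using (Vector; map; replicate; zipWith)
open import Data.Vec.Functional.Relation.Binary.Pointwise using (Pointwise)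
open import Function.Base using (_∘_)
open import Level using (0ℓ) renaming (suc to lsuc)
open import Relation.Binary.Bundles using (TotalOrder)
import Relation.Binary.Construct.NonStrictToStrict as ToStrict
open import Relation.Binary.Core using (Rel)
open import Relation.Binary.PropositionalEquality.Core as ≡ using (_≡_)
import Relation.Binary.Reasoning.PartialOrder as PosetReasoning
open import Relation.Binary.Structures using (IsTotalOrder)
open import Relation.Nullary using (¬_; yes; no)
open import Relation.Unary using (Pred; _∈_; _⊆_)

-- The real numbers, as a Dedekind-complete ordered field.  Classically
-- these axioms determine ℝ up to unique isomorphism.

module _ {A : Set} (_≤_ : Rel A 0ℓ) where

  IsUpperBound : Pred A 0ℓ → Pred A 0ℓ
  IsUpperBound P u = ∀ {x} → x ∈ P → x ≤ u

  IsSupremum : Pred A 0ℓ → Pred A 0ℓ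
  IsSupremum P s = IsUpperBound P s × (∀ {u} → IsUpperBound P u → s ≤ u)

record CompleteOrderedField : Set (lsuc 0ℓ) where
  infix 4 _≤_
  field
    commutativeRing : CommutativeRing 0ℓ 0ℓ

  open CommutativeRing commutativeRing public

  field
    _≤_          : Rel Carrier 0ℓ
    isTotalOrder : IsTotalOrder _≈_ _≤_
    +-monoˡ-≤    : ∀ {x y} z → x ≤ y → x + z ≤ y + z
    *-nonNeg     : ∀ {x y} → 0# ≤ x → 0# ≤ y → 0# ≤ x * y
    1≉0          : ¬ 1# ≈ 0#
    inverse      : ∀ x → ¬ x ≈ 0# → ∃ λ y → x * y ≈ 1#
    supremum     : ∀ (P : Pred Carrier 0ℓ) → ∃ P → ∃ (IsUpperBound _≤_ P) →
                   ∃ (IsSupremum _≤_ P)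

  totalOrder : TotalOrder 0ℓ 0ℓ 0ℓ
  totalOrder = record { isTotalOrder = isTotalOrder }

  open ToStrict _≈_ _≤_ public using (_<_)

-- Excluded middle is assumed because the mathematics is classical; here
-- it yields the Archimedean property from completeness.

module Real (em : ExcludedMiddle 0ℓ) (R : CompleteOrderedField) where

  open CompleteOrderedField R renaming (Carrier to ℝ)
  open Exp semiring using (_^_; ^-assocʳ; ^-congʳ)
  open Mult semiring using () renaming (_×_ to _×ℕ_; ×1-homo-* to ×ℕ1-homo-*)
  open Max totalOrder using (_⊔_)
  open RingProperties ring using (-‿distribʳ-*; -‿involutive; -‿+-comm)
  open IsTotalOrder isTotalOrder using (total; antisym)
    renaming (refl to ≤-refl; trans to ≤-trans; reflexive to ≤-reflexive)
  open PosetReasoning (TotalOrder.poset totalOrder)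

  ∣_∣ : ℝ → ℝ
  ∣ x ∣ = x ⊔ (- x)

  fromℕ : ℕ → ℝ
  fromℕ n = n ×ℕ 1#

  recip : ∀ {x} → 0# < x → ℝ
  recip (_ , 0≉x) = proj₁ (inverse _ (0≉x ∘ sym))

  -- Coefficients in order of increasing degree.
  Polynomial : Set
  Polynomial = List ℝ

  ⟦_⟧ : Polynomial → ℝ → ℝ
  ⟦ p ⟧ t = foldr (λ a r → a + t * r) 0# p

  +-mono-≤ : ∀ {x y u v} → x ≤ y → u ≤ v → x + u ≤ y + v
  +-mono-≤ {x} {y} {u} {v} x≤y u≤v = begin
    x + u  ≤⟨ +-monoˡ-≤ u x≤y ⟩
    y + u  ≈⟨ +-comm y u ⟩
    u + y  ≤⟨ +-monoˡ-≤ y u≤v ⟩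
    v + y  ≈⟨ +-comm v y ⟩
    y + v  ∎

  x≤y⇒0≤y-x : ∀ {x y} → x ≤ y → 0# ≤ y - x
  x≤y⇒0≤y-x {x} {y} x≤y = begin
    0#     ≈⟨ -‿inverseʳ x ⟨
    x - x  ≤⟨ +-monoˡ-≤ (- x) x≤y ⟩
    y - x  ∎

  x-y+y≈x : ∀ x y → (x - y) + y ≈ x
  x-y+y≈x x y =
    trans (+-assoc x (- y) y) (trans (+-congˡ (-‿inverseˡ y)) (+-identityʳ x))

  0≤y-x⇒x≤y : ∀ {x y} → 0# ≤ y - x → x ≤ y
  0≤y-x⇒x≤y {x} {y} h = begin
    x            ≈⟨ +-identityˡ x ⟨
    0# + x       ≤⟨ +-monoˡ-≤ x h ⟩
    (y - x) + x  ≈⟨ x-y+y≈x y x ⟩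
    y            ∎

  x≤0⇒0≤-x : ∀ {x} → x ≤ 0# → 0# ≤ - x
  x≤0⇒0≤-x {x} x≤0 = ≤-trans (x≤y⇒0≤y-x x≤0) (≤-reflexive (+-identityˡ (- x)))

  *-monoʳ-≤ : ∀ {x y z} → 0# ≤ z → x ≤ y → z * x ≤ z * y
  *-monoʳ-≤ {x} {y} {z} 0≤z x≤y = 0≤y-x⇒x≤y (begin
    0#                ≤⟨ *-nonNeg 0≤z (x≤y⇒0≤y-x x≤y) ⟩
    z * (y - x)       ≈⟨ distribˡ z y (- x) ⟩
    z * y + z * (- x) ≈⟨ +-congˡ (-‿distribʳ-* z x) ⟨
    z * y - z * x     ∎)

  *-mono-≤ : ∀ {x y u v} → 0# ≤ x → 0# ≤ v → x ≤ y → u ≤ v → x * u ≤ y * v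
  *-mono-≤ {x} {y} {u} {v} 0≤x 0≤v x≤y u≤v = begin
    x * u  ≤⟨ *-monoʳ-≤ 0≤x u≤v ⟩
    x * v  ≈⟨ *-comm x v ⟩
    v * x  ≤⟨ *-monoʳ-≤ 0≤v x≤y ⟩
    v * y  ≈⟨ *-comm v y ⟩
    y * v  ∎

  0≤1 : 0# ≤ 1#
  0≤1 with total 0# 1#
  ... | inj₁ h = h
  ... | inj₂ h = begin
    0#             ≤⟨ *-nonNeg (x≤0⇒0≤-x h) (x≤0⇒0≤-x h) ⟩
    - 1# * - 1#    ≈⟨ -‿distribʳ-* (- 1#) 1# ⟨
    - (- 1# * 1#)  ≈⟨ -‿cong (*-identityʳ (- 1#)) ⟩
    - - 1#         ≈⟨ -‿involutive 1# ⟩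
    1#             ∎

  1≰0 : ¬ 1# ≤ 0#
  1≰0 h = 1≉0 (antisym h 0≤1)

  1+x≰x : ∀ {x} → ¬ 1# + x ≤ x
  1+x≰x {x} h = 1≰0 (begin
    1#            ≈⟨ +-identityʳ 1# ⟨
    1# + 0#       ≈⟨ +-congˡ (-‿inverseʳ x) ⟨
    1# + (x - x)  ≈⟨ +-assoc 1# x (- x) ⟨
    (1# + x) - x  ≤⟨ +-monoˡ-≤ (- x) h ⟩
    x - x         ≈⟨ -‿inverseʳ x ⟩
    0#            ∎)

  0≤fromℕ : ∀ n → 0# ≤ fromℕ n
  0≤fromℕ zero    = ≤-refl
  0≤fromℕ (suc n) = begin
    0#            ≈⟨ +-identityˡ 0# ⟨
    0# + 0#       ≤⟨ +-mono-≤ 0≤1 (0≤fromℕ n) ⟩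
    1# + fromℕ n  ∎

  1≤fromℕ : ∀ n → .{{_ : NonZero n}} → 1# ≤ fromℕ n
  1≤fromℕ (suc n) = begin
    1#            ≈⟨ +-identityʳ 1# ⟨
    1# + 0#       ≤⟨ +-mono-≤ ≤-refl (0≤fromℕ n) ⟩
    1# + fromℕ n  ∎

  fromℕ-mono : ∀ {m n} → m ℕ.≤ n → fromℕ m ≤ fromℕ n
  fromℕ-mono {n = n} ℕ.z≤n = 0≤fromℕ n
  fromℕ-mono (ℕ.s≤s m≤n)   = +-mono-≤ ≤-refl (fromℕ-mono m≤n)

  fromℕ-cancel : ∀ {m n} → fromℕ m ≤ fromℕ n → m ℕ.≤ n
  fromℕ-cancel {m} {n} h with m ℕ.≤? n
  ... | yes m≤n = m≤n
  ... | no  m≰n = ⊥-elim (1+x≰x (≤-trans (fromℕ-mono (ℕ.≰⇒> m≰n)) h))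

  recip-nonNeg : ∀ {x} (0<x : 0# < x) → 0# ≤ recip 0<x
  recip-nonNeg {x} (0≤x , 0≉x) with inverse x (0≉x ∘ sym)
  ... | y , xy≈1 with total 0# y
  ...   | inj₁ h = h
  ...   | inj₂ h = ⊥-elim (1≰0 (0≤y-x⇒x≤y (begin
    0#          ≤⟨ *-nonNeg 0≤x (x≤0⇒0≤-x h) ⟩
    x * - y     ≈⟨ -‿distribʳ-* x y ⟨
    - (x * y)   ≈⟨ -‿cong xy≈1 ⟩
    - 1#        ≈⟨ +-identityˡ (- 1#) ⟨
    0# - 1#     ∎)))

  archimedean : ∀ x → ∃ λ k → x ≤ fromℕ k
  archimedean x with em {∃ λ k → x ≤ fromℕ k}
  ... | yes h = h
  ... | no  h = ⊥-elim (1+x≰x 1+s≤s)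
    where
    Naturals : Pred ℝ 0ℓ
    Naturals y = ∃ λ k → y ≡ fromℕ k

    below : IsUpperBound _≤_ Naturals x
    below (k , ≡.refl) with total (fromℕ k) x
    ... | inj₁ k≤x = k≤x
    ... | inj₂ x≤k = ⊥-elim (h (k , x≤k))

    sup = supremum Naturals (0# , 0 , ≡.refl) (x , below)
    s   = proj₁ sup

    below-pred : IsUpperBound _≤_ Naturals (s - 1#)
    below-pred (k , ≡.refl) = begin
      fromℕ k               ≈⟨ +-identityʳ _ ⟨
      fromℕ k + 0#          ≈⟨ +-congˡ (-‿inverseʳ 1#) ⟨
      fromℕ k + (1# - 1#)   ≈⟨ +-assoc _ _ _ ⟨
      (fromℕ k + 1#) - 1#   ≈⟨ +-congʳ (+-comm _ _) ⟩
      fromℕ (suc k) - 1#    ≤⟨ +-monoˡ-≤ (- 1#) (proj₁ (proj₂ sup) (suc k , ≡.refl)) ⟩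
      s - 1#                ∎

    1+s≤s : 1# + s ≤ s
    1+s≤s = begin
      1# + s         ≈⟨ +-comm 1# s ⟩
      s + 1#         ≤⟨ +-monoˡ-≤ 1# (proj₂ (proj₂ sup) below-pred) ⟩
      (s - 1#) + 1#  ≈⟨ x-y+y≈x s 1# ⟩
      s              ∎

  ^-nonNeg : ∀ {x} n → 0# ≤ x → 0# ≤ x ^ n
  ^-nonNeg zero    0≤x = 0≤1
  ^-nonNeg (suc n) 0≤x = *-nonNeg 0≤x (^-nonNeg n 0≤x)

  ^-monoˡ-≤ : ∀ {x y} n → 0# ≤ x → x ≤ y → x ^ n ≤ y ^ n
  ^-monoˡ-≤ zero    0≤x x≤y = ≤-refl
  ^-monoˡ-≤ (suc n) 0≤x x≤y =
    *-mono-≤ 0≤x (^-nonNeg n (≤-trans 0≤x x≤y)) x≤y (^-monoˡ-≤ n 0≤x x≤y)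

  1≤^ : ∀ {x} n → 1# ≤ x → 1# ≤ x ^ n
  1≤^ zero        1≤x = ≤-refl
  1≤^ {x} (suc n) 1≤x = begin
    1#         ≈⟨ *-identityˡ 1# ⟨
    1# * 1#    ≤⟨ *-mono-≤ 0≤1 (^-nonNeg n (≤-trans 0≤1 1≤x)) 1≤x (1≤^ n 1≤x) ⟩
    x * x ^ n  ∎

  ^-monoʳ-≤ : ∀ {x m n} → 1# ≤ x → m ℕ.≤ n → x ^ m ≤ x ^ n
  ^-monoʳ-≤ {n = n} 1≤x ℕ.z≤n       = 1≤^ n 1≤x
  ^-monoʳ-≤         1≤x (ℕ.s≤s m≤n) =
    *-monoʳ-≤ (≤-trans 0≤1 1≤x) (^-monoʳ-≤ 1≤x m≤n)

  ^-cancelˡ-≤ : ∀ {s t} n → .{{_ : NonZero n}} → 1# ≤ t → s ^ n ≤ t ^ n → s ≤ t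
  ^-cancelˡ-≤ {s} {t} (suc n) 1≤t h with total s t
  ... | inj₁ s≤t = s≤t
  ... | inj₂ t≤s = 0≤y-x⇒x≤y (begin
    0#                       ≤⟨ x≤y⇒0≤y-x h′ ⟩
    t * t ^ n - (δ + t * t ^ n)   ≈⟨ +-congˡ (sym (-‿+-comm δ (t * t ^ n))) ⟩
    t * t ^ n + (- δ - t * t ^ n) ≈⟨ +-congˡ (+-comm (- δ) (- (t * t ^ n))) ⟩
    t * t ^ n + (- (t * t ^ n) - δ) ≈⟨ +-assoc _ _ _ ⟨
    (t * t ^ n - t * t ^ n) - δ   ≈⟨ +-congʳ (-‿inverseʳ _) ⟩
    0# - δ                   ≈⟨ +-identityˡ _ ⟩
    - δ                      ≈⟨ -‿+-comm s (- t) ⟨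
    - s - - t                ≈⟨ +-congˡ (-‿involutive t) ⟩
    - s + t                  ≈⟨ +-comm (- s) t ⟩
    t - s                    ∎)
    where
    δ = s - t
    0≤t = ≤-trans 0≤1 1≤t
    h′ : δ + t * t ^ n ≤ t * t ^ n
    h′ = begin
      δ + t * t ^ n           ≈⟨ +-congʳ (*-identityʳ δ) ⟨
      δ * 1# + t * t ^ n      ≤⟨ +-monoˡ-≤ _ (*-monoʳ-≤ (x≤y⇒0≤y-x t≤s) (1≤^ n 1≤t)) ⟩
      δ * t ^ n + t * t ^ n   ≈⟨ distribʳ (t ^ n) δ t ⟨
      (δ + t) * t ^ n         ≈⟨ *-congʳ (x-y+y≈x s t) ⟩
      s * t ^ n               ≤⟨ *-monoʳ-≤ (≤-trans 0≤t t≤s) (^-monoˡ-≤ n 0≤t t≤s) ⟩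
      s * s ^ n               ≤⟨ h ⟩
      t * t ^ n               ∎

  -- Real powers: for b ≥ 1 and p ≥ 0, bᵖ is the supremum of the rational
  -- powers b^(m/n) with 0 ≤ m/n ≤ p, where s = b^(m/n) is the
  -- nonnegative solution of sⁿ = bᵐ.

  RationalPowersBelow : ℝ → ℝ → Pred ℝ 0ℓ
  RationalPowersBelow b p s =
    0# ≤ s ×
    ∃₂ λ m n → NonZero n × fromℕ m ≤ fromℕ n * p × s ^ n ≈ b ^ m

  rationalPowersBelow-bounded : ∀ {b p} → 1# ≤ b →
    ∃ (IsUpperBound _≤_ (RationalPowersBelow b p))
  rationalPowersBelow-bounded {b} {p} 1≤b with archimedean p
  ... | k , p≤k = b ^ k , bound
    where
    bound : IsUpperBound _≤_ (RationalPowersBelow b p) (b ^ k)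
    bound {s} (_ , m , n , n≢0 , m≤np , sⁿ≈bᵐ) =
      ^-cancelˡ-≤ n {{n≢0}} (1≤^ k 1≤b) (begin
        s ^ n          ≈⟨ sⁿ≈bᵐ ⟩
        b ^ m          ≤⟨ ^-monoʳ-≤ {n = n ℕ.* k} 1≤b (fromℕ-cancel {m} {n ℕ.* k} m≤nk) ⟩
        b ^ (n ℕ.* k)  ≈⟨ ^-congʳ b (ℕ.*-comm n k) ⟩
        b ^ (k ℕ.* n)  ≈⟨ ^-assocʳ b k n ⟨
        (b ^ k) ^ n    ∎)
      where
      m≤nk : fromℕ m ≤ fromℕ (n ℕ.* k)
      m≤nk = begin
        fromℕ m            ≤⟨ m≤np ⟩
        fromℕ n * p        ≤⟨ *-monoʳ-≤ (0≤fromℕ n) p≤k ⟩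
        fromℕ n * fromℕ k  ≈⟨ ×ℕ1-homo-* n k ⟨
        fromℕ (n ℕ.* k)    ∎

  rationalPowersBelow-nonempty : ∀ {b p} → 0# ≤ p → ∃ (RationalPowersBelow b p)
  rationalPowersBelow-nonempty {b} {p} 0≤p =
    1# , 0≤1 , 0 , 1 , _ , *-nonNeg (0≤fromℕ 1) 0≤p , *-identityʳ 1#

  power : ∀ b p → 1# ≤ b → 0# ≤ p → ℝ
  power b p 1≤b 0≤p = proj₁ (supremum (RationalPowersBelow b p)
    (rationalPowersBelow-nonempty 0≤p) (rationalPowersBelow-bounded 1≤b))

  module _ {d : ℕ} where

    infix 4 _≋_ _≼_

    _≋_ : Rel (Vector ℝ d) 0ℓ
    _≋_ = Pointwise _≈_

    _≼_ : Rel (Vector ℝ d) 0ℓ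
    _≼_ = Pointwise _≤_

    0ᵥ : Vector ℝ d
    0ᵥ = replicate d 0#

    NonNegOrthant : Pred (Vector ℝ d) 0ℓ
    NonNegOrthant x = 0ᵥ ≼ x

    record IsNorm (f : Vector ℝ d → ℝ) : Set where
      field
        cong        : ∀ {x y} → x ≋ y → f x ≈ f y
        nonNeg      : ∀ x → 0# ≤ f x
        definite    : ∀ {x} → f x ≈ 0# → x ≋ 0ᵥ
        homogeneous : ∀ c x → f (map (c *_) x) ≈ ∣ c ∣ * f x
        triangle    : ∀ x y → f (zipWith _+_ x y) ≤ f x + f y

    record IsSymmetricMonotonicNorm (f : Vector ℝ d → ℝ) : Set where
      field
        isNorm    : IsNorm f
        symmetric : ∀ (π : Permutation′ d) x → f (x ∘ (π ⟨$⟩ʳ_)) ≈ f x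
        monotonic : ∀ {x y} → x ∈ NonNegOrthant → x ≼ y → f x ≤ f y
      open IsNorm isNorm public

    IsMinimum : (Vector ℝ d → ℝ) → Pred (Vector ℝ d) 0ℓ → Pred ℝ 0ℓ
    IsMinimum f S m = (∃ λ x → x ∈ S × f x ≈ m) × (∀ {x} → x ∈ S → m ≤ f x)

    AttainsMinimum : (Vector ℝ d → ℝ) → Pred (Vector ℝ d) 0ℓ → Set
    AttainsMinimum f S = ∃ (IsMinimum f S)

    -- Functions D → ℝ are represented by functions on the whole of ℝᵈ,
    -- of which only the values on D matter.  Both minima are required to
    -- exist, so that e.g. the empty set is not vacuously a portfolio.
    record IsPortfolio (α : ℝ) (C : Pred (Vector ℝ d → ℝ) 0ℓ)
                       (D X : Pred (Vector ℝ d) 0ℓ) : Set where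
      field
        subset      : X ⊆ D
        approximate : ∀ {f} → f ∈ C → ∃₂ λ m m* →
                      IsMinimum f X m × IsMinimum f D m* × m ≤ α * m*

{-# OPTIONS --safe #-}
module Submission where

open import Defs
open import Axiom.ExcludedMiddle using (ExcludedMiddle)
open import Data.List.Base using (List; length)
open import Data.List.Membership.Propositional using () renaming (_∈_ to _∈ₗ_)
open import Data.Nat.Base using (ℕ; NonZero)
open import Data.Product.Base using (∃; _×_)
open import Data.Vec.Functional using (Vector)
open import Level using (0ℓ)
open import Relation.Unary using (Pred; _⊆_; Satisfiable)
import Algebra.Construct.NaturalChoice.Max as Max
import Algebra.Properties.CommutativeMonoid.Sum as CommutativeMonoidSum
import Algebra.Properties.Ring as RingProperties
import Algebra.Properties.Semiring.Exp as Exp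
import Algebra.Properties.Semiring.Mult as Mult
import Algebra.Properties.Semiring.Sum as SemiringSum
import Algebra.Solver.Ring.NaturalCoefficients.Default as SemiringSolver
open import Data.Fin.Base using (Fin; toℕ; punchIn; punchOut)
  renaming (zero to fzero; suc to fsuc; fromℕ to maxFin)
open import Data.Fin.Permutation as Perm
  using (Permutation′; _⟨$⟩ʳ_; lift₀; insert; insert-punchIn)
import Data.Fin.Properties as Fin
import Data.List.Base as List
import Data.List.Extrema as Extrema
open import Data.List.Membership.Propositional.Properties
  using (∈-++⁺ˡ; ∈-++⁺ʳ; ∈-map⁺; ∈-map⁻)
import Data.List.Properties as List
import Data.List.Relation.Unary.All as All
open import Data.List.Relation.Unary.Any using (here)
open import Data.Nat.Base as ℕ using (zero; suc; z≤n; s≤s)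
open import Data.Nat.DivMod
  using (_/_; _%_; m/n≡1+[m∸n]/n; m≡m%n+[m/n]*n; m%n<n; m*n/n≡m; m/n*n≤m; m<n⇒m/n≡0; /-monoˡ-≤)
import Data.Nat.Properties as ℕ
open import Data.Nat.Tactic.RingSolver using (solve-∀)
open import Data.Product.Base using (_,_; proj₁; proj₂)
open import Data.Sum.Base using (inj₁; inj₂)
open import Data.Vec.Functional using (map; replicate; zipWith; foldr)
open import Function.Base using (_∘_)
open import Relation.Binary.Bundles using (TotalOrder)
open import Relation.Binary.PropositionalEquality.Core as ≡ using (_≡_)
import Relation.Binary.Reasoning.PartialOrder as PosetReasoning
open import Relation.Binary.Structures using (IsTotalOrder)
open import Relation.Nullary using (yes; no; contradiction)
open import Relation.Unary using (_∈_)

-- Let μ be the least maximum norm over D and T ≈ 4/ε.  For every norm f, each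
-- coordinate x k satisfies x k * f 1 ≤ d * f x; hence μ * f 1 ≤ d * f x on D,
-- and the minimizers of f have their coordinates in [0, dμ].  Sort x in
-- decreasing order, keep only the entries at the ranks grid 0, grid 1, …, and
-- round these, measured in units of μ/(dT), down to the same grid.  Rounding the
-- ranks changes f by a factor of at most 1 + 1/T: the dilated vector is the
-- average of T + 1 vectors, each (1 + 1/T) times a vector dominated by a
-- permutation of x.  Rounding the values costs another factor 1 + 1/T and one
-- unit in each coordinate, that is at most f x / T.  So one vector of D for each
-- rounded sequence suffices, and as these sequences are antitone they are
-- lattice paths with O(T log d) steps, of which there are d^O(T).

-- Natural numbers: the grid, compressing permutations and the path count.

module _ where

  open import Data.Nat.Base using (_+_; _*_; _^_; _≤_; _<_; _∸_)
  open import Data.Nat.Properties using (module ≤-Reasoning)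

  -- `l` serves as an integer logarithm of d: the lower bound lets l doublings reach d, the upper
  -- one turns powers of `2 ^ l` back into powers of d.
  ∃-2^-between : ∀ n → ∃ λ l → suc n ≤ 2 ^ l × 2 ^ l ≤ 2 * suc n
  ∃-2^-between zero = 0 , ℕ.≤-refl , s≤s z≤n
  ∃-2^-between (suc n) with ∃-2^-between n
  ... | l , lb , ub with suc (suc n) ℕ.≤? 2 ^ l
  ...   | yes h = l , h , ℕ.≤-trans ub (ℕ.*-monoʳ-≤ 2 (ℕ.n≤1+n (suc n)))
  ...   | no h = suc l , (begin
          suc (suc n)        ≤⟨ s≤s (s≤s (ℕ.m≤m+n n (n + 0))) ⟩
          2 + 2 * n          ≡⟨ ℕ.*-suc 2 n ⟨
          2 * suc n          ≤⟨ ℕ.*-monoʳ-≤ 2 lb ⟩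
          2 * 2 ^ l          ∎)
        , ℕ.*-monoʳ-≤ 2 (ℕ.<⇒≤ (ℕ.≰⇒> h))
    where open ≤-Reasoning

  [n+d]/d : ∀ n d .{{_ : NonZero d}} → (n + d) / d ≡ suc (n / d)
  [n+d]/d n d = ≡.trans (m/n≡1+[m∸n]/n (ℕ.m≤n+m d n))
    (≡.cong (λ m → suc (m / d)) (ℕ.m+n∸n≡m n d))

  [1+n]/d≤1+n/d : ∀ n d .{{_ : NonZero d}} → suc n / d ≤ suc (n / d)
  [1+n]/d≤1+n/d n d = begin
    suc n / d      ≤⟨ /-monoˡ-≤ d (ℕ.≤-trans (ℕ.≤-reflexive (ℕ.+-comm 1 n)) (ℕ.+-monoʳ-≤ n (ℕ.>-nonZero⁻¹ d))) ⟩
    (n + d) / d    ≡⟨ [n+d]/d n d ⟩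
    suc (n / d)    ∎
    where open ≤-Reasoning

  -- Consecutive points differ by 1 up to T and by a factor of about 1 + 1/T from
  -- there on.  The same sequence is used to round both ranks and values.
  grid : (T : ℕ) .{{_ : NonZero T}} → ℕ → ℕ
  grid T zero    = 0
  grid T (suc j) = suc (grid T j + grid T j / T)

  module _ (T : ℕ) .{{_ : NonZero T}} where

    open ≤-Reasoning

    grid-step : ∀ j → T * grid T (suc j) ≤ suc T * grid T j + T
    grid-step j = begin
      T * suc (g + g / T)      ≡⟨ expand T g (g / T) ⟩
      (g / T * T + T * g) + T  ≤⟨ ℕ.+-monoˡ-≤ T (ℕ.+-monoˡ-≤ (T * g) (m/n*n≤m g T)) ⟩
      suc T * g + T            ∎
      where
      g = grid T j
      expand : ∀ t g q → t * suc (g + q) ≡ (q * t + t * g) + t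
      expand = solve-∀

    -- The increments of the grid never decrease, so each of the i steps gains at least the first
    -- increment.
    grid-+ : ∀ i j → grid T j + i * suc (grid T j / T) ≤ grid T (i + j)
    grid-+ zero    j = ℕ.≤-reflexive (ℕ.+-identityʳ _)
    grid-+ (suc i) j = begin
      g + suc i * suc (g / T)              ≡⟨ expand g i (g / T) ⟩
      suc (g + i * suc (g / T) + g / T)    ≤⟨ s≤s (ℕ.+-mono-≤ ih (/-monoˡ-≤ T (ℕ.m+n≤o⇒m≤o g ih))) ⟩
      suc (grid T (i + j) + grid T (i + j) / T) ∎
      where
      g  = grid T j
      ih = grid-+ i j
      expand : ∀ g i q → g + suc i * suc q ≡ suc (g + i * suc q + q)
      expand = solve-∀

    n≤grid : ∀ n → n ≤ grid T n
    n≤grid zero    = z≤n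
    n≤grid (suc n) = s≤s (ℕ.≤-trans (n≤grid n) (ℕ.m≤m+n _ _))

    -- `suc (g / T)` is at least the exact quotient of g by T, and each of the next `T` steps gains
    -- at least that much.
    grid-doubles : ∀ j → 2 * grid T j ≤ grid T (T + j)
    grid-doubles j = begin
      2 * g                      ≡⟨ ≡.cong (g +_) (ℕ.+-identityʳ g) ⟩
      g + g                      ≡⟨ ≡.cong (g +_) (m≡m%n+[m/n]*n g T) ⟩
      g + (g % T + g / T * T)    ≤⟨ ℕ.+-monoʳ-≤ g (ℕ.+-monoˡ-≤ _ (ℕ.<⇒≤ (m%n<n g T))) ⟩
      g + (T + g / T * T)        ≡⟨ ≡.cong (g +_) (ℕ.*-comm (suc (g / T)) T) ⟩
      g + T * suc (g / T)        ≤⟨ grid-+ T j ⟩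
      grid T (T + j)             ∎
      where g = grid T j

    grid-exp : ∀ l j → 2 ^ l * grid T j ≤ grid T (l * T + j)
    grid-exp zero    j = ℕ.≤-reflexive (ℕ.+-identityʳ _)
    grid-exp (suc l) j = begin
      2 * 2 ^ l * grid T j        ≡⟨ ℕ.*-assoc 2 (2 ^ l) _ ⟩
      2 * (2 ^ l * grid T j)      ≤⟨ ℕ.*-monoʳ-≤ 2 (grid-exp l j) ⟩
      2 * grid T (l * T + j)      ≤⟨ grid-doubles (l * T + j) ⟩
      grid T (T + (l * T + j))    ≡⟨ ≡.cong (grid T) (ℕ.+-assoc T (l * T) j) ⟨
      grid T (T + l * T + j)      ∎

    -- Doubling starts at index 1 because `grid T 0` is 0. For n = d this many grid ranks suffice to
    -- cover all coordinates.
    n≤grid[l*T+1] : ∀ {n} l → n ≤ 2 ^ l → n ≤ grid T (l * T + 1)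
    n≤grid[l*T+1] {n} l n≤2^l = begin
      n                    ≤⟨ n≤2^l ⟩
      2 ^ l                ≡⟨ ℕ.*-identityʳ (2 ^ l) ⟨
      2 ^ l * 1            ≤⟨ ℕ.*-monoʳ-≤ (2 ^ l) (n≤grid 1) ⟩
      2 ^ l * grid T 1     ≤⟨ grid-exp l 1 ⟩
      grid T (l * T + 1)   ∎

    -- Index `T` already gives at least `T`, and `2 * l` doublings multiply this by at least the
    -- square of n. For n = d the left side is the bound dμ on minimizers, in units of μ/(dT).
    n*T*n≤grid[2*l*T+T] : ∀ {n} l → n ≤ 2 ^ l → n * T * n ≤ grid T ((2 * l) * T + T)
    n*T*n≤grid[2*l*T+T] {n} l n≤2^l = begin
      n * T * n                   ≤⟨ ℕ.*-mono-≤ (ℕ.*-monoˡ-≤ T n≤2^l) n≤2^l ⟩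
      2 ^ l * T * 2 ^ l           ≡⟨ regroup (2 ^ l) T ⟩
      (2 ^ l) ^ 2 * T             ≡⟨ ≡.cong (_* T) (ℕ.^-*-assoc 2 l 2) ⟩
      2 ^ (l * 2) * T             ≡⟨ ≡.cong (λ e → 2 ^ e * T) (ℕ.*-comm l 2) ⟩
      2 ^ (2 * l) * T             ≤⟨ ℕ.*-monoʳ-≤ (2 ^ (2 * l)) (n≤grid T) ⟩
      2 ^ (2 * l) * grid T T      ≤⟨ grid-exp (2 * l) T ⟩
      grid T ((2 * l) * T + T)    ∎
      where
      regroup : ∀ p t → p * t * p ≡ p * (p * 1) * t
      regroup = solve-∀

    grid-locate : ∀ n {k} → k < grid T n →
      ∃ λ j → j < n × grid T j ≤ k × k < grid T (suc j)
    grid-locate (suc n) {k} k<g with grid T n ℕ.≤? k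
    ... | yes g≤k = n , ℕ.≤-refl , g≤k , k<g
    ... | no  g≰k with grid-locate n (ℕ.≰⇒> g≰k)
    ...   | j , j<n , h = j , ℕ.m<n⇒m<1+n j<n , h

    -- The excess a = k - g satisfies a * T ≤ g, hence a * suc T ≤ g + a = k. This form of the error
    -- matches the colouring of ranks with `suc T` colours.
    grid-gap : ∀ j {k} → grid T j ≤ k → k < grid T (suc j) → k ≤ grid T j + k / suc T
    grid-gap j {k} g≤k (s≤s k≤g+q) = begin
      k              ≡⟨ ℕ.m+[n∸m]≡n g≤k ⟨
      g + a          ≤⟨ ℕ.+-monoʳ-≤ g (m*n≤o⇒m≤o/n a (suc T) k a[1+T]≤k) ⟩
      g + k / suc T  ∎
      where
      g = grid T j
      a = k ∸ g
      m*n≤o⇒m≤o/n : ∀ m n o .{{_ : NonZero n}} → m * n ≤ o → m ≤ o / n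
      m*n≤o⇒m≤o/n m n o h = ℕ.≤-trans (ℕ.≤-reflexive (≡.sym (m*n/n≡m m n))) (/-monoˡ-≤ n h)
      a[1+T]≤k : a * suc T ≤ k
      a[1+T]≤k = begin
        a * suc T      ≡⟨ ℕ.*-suc a T ⟩
        a + a * T      ≤⟨ ℕ.+-monoʳ-≤ a (ℕ.*-monoˡ-≤ T (ℕ.m≤n+o⇒m∸n≤o k g k≤g+q)) ⟩
        a + g / T * T  ≤⟨ ℕ.+-monoʳ-≤ a (m/n*n≤m g T) ⟩
        a + g          ≡⟨ ℕ.m∸n+n≡m g≤k ⟩
        k              ∎

  toℕ-punchIn-max : ∀ n (i : Fin n) → toℕ (punchIn (maxFin n) i) ≡ toℕ i
  toℕ-punchIn-max (suc n) fzero    = ≡.refl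
  toℕ-punchIn-max (suc n) (fsuc i) = ≡.cong suc (toℕ-punchIn-max n i)

  -- Moves the points where h does not jump to the front, in order; h k ∸ h 0
  -- counts the jumps below k.
  compress : ∀ d (h : ℕ → ℕ) → (∀ n → h (suc n) ≤ suc (h n)) →
    ∃ λ (π : Permutation′ d) → ∀ k → h (suc (toℕ k)) ≡ h (toℕ k) →
    toℕ (π ⟨$⟩ʳ k) + h (toℕ k) ≤ toℕ k + h 0
  compress zero    h step = Perm.id , λ ()
  compress (suc d) h step with compress d (λ n → h (suc n)) (λ n → step (suc n)) | h 1 ℕ.≟ h 0
  ... | π , bound | yes h1≡h0 = lift₀ π , λ where
    fzero    _  → ℕ.≤-refl
    (fsuc k) eq → s≤s (ℕ.≤-trans (bound k eq) (ℕ.≤-reflexive (≡.cong (toℕ k +_) h1≡h0)))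
  -- The point 0 jumps, so it goes to the last position; every other point moves forward by one,
  -- which pays for the jump.
  ... | π , bound | no  h1≢h0 = insert fzero (maxFin d) π , λ where
    fzero    eq → contradiction eq h1≢h0
    (fsuc k) eq → begin
      toℕ (insert fzero (maxFin d) π ⟨$⟩ʳ fsuc k) + h (suc (toℕ k))
        ≡⟨ ≡.cong (λ i → toℕ i + h (suc (toℕ k))) (insert-punchIn fzero (maxFin d) π k) ⟩
      toℕ (punchIn (maxFin d) (π ⟨$⟩ʳ k)) + h (suc (toℕ k))
        ≡⟨ ≡.cong (_+ h (suc (toℕ k))) (toℕ-punchIn-max d (π ⟨$⟩ʳ k)) ⟩
      toℕ (π ⟨$⟩ʳ k) + h (suc (toℕ k))  ≤⟨ bound k eq ⟩
      toℕ k + h 1                       ≤⟨ ℕ.+-monoʳ-≤ (toℕ k) (step 0) ⟩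
      toℕ k + suc (h 0)                 ≡⟨ ℕ.+-suc (toℕ k) (h 0) ⟩
      suc (toℕ k) + h 0                 ∎
      where open ≤-Reasoning

  -- Since 2 ≤ d, both 2 and `2 ^ l` are bounded by powers of d, and the exponent becomes 6T + 1 + T
  -- ≤ 8T. For d = 1 no power of d would do.
  path-count : ∀ d T k l → 2 ≤ d → T ≤ 8 * suc k → 1 ≤ T → 2 ^ l ≤ 2 * d →
    2 ^ ((l * T + 1) + ((2 * l) * T + T)) ≤ d ^ (suc k * 64)
  path-count d T k l 2≤d T≤8+8k 1≤T 2^l≤2d = begin
    2 ^ ((l * T + 1) + ((2 * l) * T + T))
      ≡⟨ ≡.cong (2 ^_) (regroup l T) ⟩
    2 ^ (l * (3 * T) + (1 + T))
      ≡⟨ ℕ.^-distribˡ-+-* 2 (l * (3 * T)) (1 + T) ⟩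
    2 ^ (l * (3 * T)) * 2 ^ (1 + T)
      ≡⟨ ≡.cong (_* 2 ^ (1 + T)) (ℕ.^-*-assoc 2 l (3 * T)) ⟨
    (2 ^ l) ^ (3 * T) * 2 ^ (1 + T)
      ≤⟨ ℕ.*-mono-≤ (ℕ.^-monoˡ-≤ (3 * T) 2^l≤d²) (ℕ.^-monoˡ-≤ (1 + T) 2≤d) ⟩
    (d ^ 2) ^ (3 * T) * d ^ (1 + T)
      ≡⟨ ≡.cong (_* d ^ (1 + T)) (ℕ.^-*-assoc d 2 (3 * T)) ⟩
    d ^ (2 * (3 * T)) * d ^ (1 + T)
      ≡⟨ ℕ.^-distribˡ-+-* d (2 * (3 * T)) (1 + T) ⟨
    d ^ (2 * (3 * T) + (1 + T))
      ≤⟨ ℕ.^-monoʳ-≤ d {{d≢0}} (begin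
        2 * (3 * T) + (1 + T)    ≤⟨ ℕ.+-monoʳ-≤ (2 * (3 * T)) (ℕ.+-monoˡ-≤ T 1≤T) ⟩
        2 * (3 * T) + (T + T)    ≡⟨ eight T ⟩
        8 * T                    ≤⟨ ℕ.*-monoʳ-≤ 8 T≤8+8k ⟩
        8 * (8 * suc k)          ≡⟨ sixty-four k ⟩
        suc k * 64               ∎) ⟩
    d ^ (suc k * 64) ∎
    where
    d≢0 : NonZero d
    d≢0 = ℕ.>-nonZero (ℕ.≤-trans (s≤s z≤n) 2≤d)
    2^l≤d² : 2 ^ l ≤ d ^ 2
    2^l≤d² = ℕ.≤-trans 2^l≤2d (ℕ.*-mono-≤ 2≤d (ℕ.≤-reflexive (≡.sym (ℕ.*-identityʳ d))))
    regroup : ∀ l T → (l * T + 1) + ((2 * l) * T + T) ≡ l * (3 * T) + (1 + T)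
    regroup = solve-∀
    eight : ∀ T → 2 * (3 * T) + (T + T) ≡ 8 * T
    eight = solve-∀
    sixty-four : ∀ k → 8 * (8 * suc k) ≡ suc k * 64
    sixty-four = solve-∀
    open ≤-Reasoning

module _ (em : ExcludedMiddle 0ℓ) (R : CompleteOrderedField) where

  open CompleteOrderedField R hiding (zero) renaming (Carrier to ℝ)
  open Real em R
  open CommutativeMonoidSum +-commutativeMonoid using (sum; sum-cong-≗)
  open Exp semiring using (_^_; ^-assocʳ)
  open Max totalOrder
    using (_⊔_; ⊔-cong; ⊔-comm; ⊔-lub; x≤x⊔y; x≤y⊔x; x≤y⇒y⊔x≈y; x≤y⇒x⊔y≈y; mono-≤-distrib-⊔)
  open Mult semiring using (×-homo-+; ×1-homo-*)
  open RingProperties ring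
    using (-‿distribˡ-*; -‿distribʳ-*; -‿involutive; -‿+-comm; +-cancelʳ)
  open SemiringSolver commutativeSemiring using (solve; _:+_; _:*_; _:=_)
  open SemiringSum semiring using (*-distribʳ-sum)
  open IsTotalOrder isTotalOrder using (total; antisym)
    renaming (refl to ≤-refl; trans to ≤-trans; reflexive to ≤-reflexive)
  open PosetReasoning (TotalOrder.poset totalOrder)

  -- Order and absolute value in the field.

  *-cancelˡ-≤ : ∀ {c x y} → 0# < c → c * x ≤ c * y → x ≤ y
  *-cancelˡ-≤ {c} {x} {y} 0<c cx≤cy = begin
    x            ≈⟨ cancel x ⟨
    r * (c * x)  ≤⟨ *-monoʳ-≤ (recip-nonNeg 0<c) cx≤cy ⟩
    r * (c * y)  ≈⟨ cancel y ⟩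
    y            ∎
    where
    r = recip 0<c
    cancel : ∀ x → r * (c * x) ≈ x
    cancel x = trans (sym (*-assoc r c x))
      (trans (*-congʳ (trans (*-comm r c) (proj₂ (inverse c (proj₂ 0<c ∘ sym))))) (*-identityˡ x))

  0<fromℕ : ∀ n → .{{_ : NonZero n}} → 0# < fromℕ n
  0<fromℕ n = 0≤fromℕ n , λ 0≈n → 1≰0 (≤-trans (1≤fromℕ n) (≤-reflexive (sym 0≈n)))

  x≤0⇒x≤-x : ∀ {x} → x ≤ 0# → x ≤ - x
  x≤0⇒x≤-x x≤0 = ≤-trans x≤0 (x≤0⇒0≤-x x≤0)

  0≤x⇒-x≤0 : ∀ {x} → 0# ≤ x → - x ≤ 0#
  0≤x⇒-x≤0 {x} 0≤x = 0≤y-x⇒x≤y (begin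
    0#            ≤⟨ 0≤x ⟩
    x             ≈⟨ -‿involutive x ⟨
    - - x         ≈⟨ +-identityˡ _ ⟨
    0# - - x      ∎)

  0≤x⇒∣x∣≈x : ∀ {x} → 0# ≤ x → ∣ x ∣ ≈ x
  0≤x⇒∣x∣≈x 0≤x = x≤y⇒y⊔x≈y (≤-trans (0≤x⇒-x≤0 0≤x) 0≤x)

  x≤0⇒∣x∣≈-x : ∀ {x} → x ≤ 0# → ∣ x ∣ ≈ - x
  x≤0⇒∣x∣≈-x x≤0 = x≤y⇒x⊔y≈y (x≤0⇒x≤-x x≤0)

  0≤∣x∣ : ∀ x → 0# ≤ ∣ x ∣
  0≤∣x∣ x with total 0# x
  ... | inj₁ 0≤x = ≤-trans 0≤x (x≤x⊔y x (- x))
  ... | inj₂ x≤0 = ≤-trans (x≤0⇒0≤-x x≤0) (x≤y⊔x x (- x))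

  ∣-∣-cong : ∀ {x y} → x ≈ y → ∣ x ∣ ≈ ∣ y ∣
  ∣-∣-cong x≈y = ⊔-cong x≈y (-‿cong x≈y)

  ∣-x∣≈∣x∣ : ∀ x → ∣ - x ∣ ≈ ∣ x ∣
  ∣-x∣≈∣x∣ x = trans (⊔-cong refl (-‿involutive x)) (⊔-comm (- x) x)

  ∣x∣≤0⇒x≈0 : ∀ {x} → ∣ x ∣ ≤ 0# → x ≈ 0#
  ∣x∣≤0⇒x≈0 {x} ∣x∣≤0 = antisym (≤-trans (x≤x⊔y x (- x)) ∣x∣≤0) (begin
    0#      ≤⟨ x≤0⇒0≤-x (≤-trans (x≤y⊔x x (- x)) ∣x∣≤0) ⟩
    - - x   ≈⟨ -‿involutive x ⟩
    x       ∎)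

  ∣x+y∣≤∣x∣+∣y∣ : ∀ x y → ∣ x + y ∣ ≤ ∣ x ∣ + ∣ y ∣
  ∣x+y∣≤∣x∣+∣y∣ x y = ⊔-lub (+-mono-≤ (x≤x⊔y x (- x)) (x≤x⊔y y (- y))) (begin
    - (x + y)        ≈⟨ -‿+-comm x y ⟨
    - x - y          ≤⟨ +-mono-≤ (x≤y⊔x x (- x)) (x≤y⊔x y (- y)) ⟩
    ∣ x ∣ + ∣ y ∣    ∎)

  ∣cx∣≈c∣x∣ : ∀ {c} x → 0# ≤ c → ∣ c * x ∣ ≈ c * ∣ x ∣
  ∣cx∣≈c∣x∣ {c} x 0≤c = trans (⊔-cong refl (-‿distribʳ-* c x))
    (sym (mono-≤-distrib-⊔ *-congˡ (*-monoʳ-≤ 0≤c) x (- x)))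

  ∣cx∣≈∣c∣∣x∣ : ∀ c x → ∣ c * x ∣ ≈ ∣ c ∣ * ∣ x ∣
  ∣cx∣≈∣c∣∣x∣ c x with total 0# c
  ... | inj₁ 0≤c = trans (∣cx∣≈c∣x∣ x 0≤c) (*-congʳ (sym (0≤x⇒∣x∣≈x 0≤c)))
  ... | inj₂ c≤0 = begin-equality
    ∣ c * x ∣      ≈⟨ ∣-x∣≈∣x∣ (c * x) ⟨
    ∣ - (c * x) ∣  ≈⟨ ∣-∣-cong (-‿distribˡ-* c x) ⟩
    ∣ - c * x ∣    ≈⟨ ∣cx∣≈c∣x∣ x (x≤0⇒0≤-x c≤0) ⟩
    - c * ∣ x ∣    ≈⟨ *-congʳ (x≤0⇒∣x∣≈-x c≤0) ⟨
    ∣ c ∣ * ∣ x ∣  ∎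

  -- The maximum norm.

  maxNorm : ∀ {d} → Vector ℝ d → ℝ
  maxNorm x = foldr _⊔_ 0# (map ∣_∣ x)

  ∣xₖ∣≤maxNorm : ∀ {d} (x : Vector ℝ d) k → ∣ x k ∣ ≤ maxNorm x
  ∣xₖ∣≤maxNorm x fzero    = x≤x⊔y _ _
  ∣xₖ∣≤maxNorm x (fsuc k) = ≤-trans (∣xₖ∣≤maxNorm (x ∘ fsuc) k) (x≤y⊔x _ _)

  maxNorm-least : ∀ {d} (x : Vector ℝ d) {u} → 0# ≤ u → (∀ k → ∣ x k ∣ ≤ u) → maxNorm x ≤ u
  maxNorm-least {zero}  x 0≤u x≤u = 0≤u
  maxNorm-least {suc d} x 0≤u x≤u =
    ⊔-lub (x≤u fzero) (maxNorm-least (x ∘ fsuc) 0≤u (x≤u ∘ fsuc))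

  0≤maxNorm : ∀ {d} (x : Vector ℝ d) → 0# ≤ maxNorm x
  0≤maxNorm {zero}  x = ≤-refl
  0≤maxNorm {suc d} x = ≤-trans (0≤∣x∣ (x fzero)) (x≤x⊔y _ _)

  maxNorm-homogeneous : ∀ {d} c (x : Vector ℝ d) → maxNorm (map (c *_) x) ≈ ∣ c ∣ * maxNorm x
  maxNorm-homogeneous {zero}  c x = sym (zeroʳ ∣ c ∣)
  maxNorm-homogeneous {suc d} c x = trans
    (⊔-cong (∣cx∣≈∣c∣∣x∣ c (x fzero)) (maxNorm-homogeneous c (x ∘ fsuc)))
    (sym (mono-≤-distrib-⊔ *-congˡ (*-monoʳ-≤ (0≤∣x∣ c)) _ _))

  -- Lets the attainment hypothesis be applied to the maximum norm, which yields μ. Congruence,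
  -- symmetry and monotonicity all come from `≤-by`, which matches coordinates.
  maxNorm-isSymmetricMonotonicNorm : ∀ {d} → IsSymmetricMonotonicNorm (maxNorm {d})
  maxNorm-isSymmetricMonotonicNorm = record
    { isNorm = record
      { cong        = λ x≋y → antisym (≤-by (λ k → k , ≤-reflexive (∣-∣-cong (x≋y k))))
                                      (≤-by (λ k → k , ≤-reflexive (∣-∣-cong (sym (x≋y k)))))
      ; nonNeg      = 0≤maxNorm
      ; definite    = λ {x} ‖x‖≈0 k →
          ∣x∣≤0⇒x≈0 (≤-trans (∣xₖ∣≤maxNorm x k) (≤-reflexive ‖x‖≈0))
      ; homogeneous = maxNorm-homogeneous
      ; triangle    = λ x y → maxNorm-least _
          (≤-trans (≤-reflexive (sym (+-identityˡ 0#))) (+-mono-≤ (0≤maxNorm x) (0≤maxNorm y)))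
          (λ k → ≤-trans (∣x+y∣≤∣x∣+∣y∣ (x k) (y k))
                         (+-mono-≤ (∣xₖ∣≤maxNorm x k) (∣xₖ∣≤maxNorm y k)))
      }
    ; symmetric = λ π x → antisym
        (≤-by (λ k → π ⟨$⟩ʳ k , ≤-refl))
        (≤-by (λ k → π Perm.⟨$⟩ˡ k ,
          ≤-reflexive (reflexive (≡.cong (λ i → ∣ x i ∣) (≡.sym (Perm.inverseʳ π))))))
    ; monotonic = λ {x} {y} 0≤x x≤y → ≤-by (λ k → k , (begin
        ∣ x k ∣  ≈⟨ 0≤x⇒∣x∣≈x (0≤x k) ⟩
        x k      ≤⟨ x≤y k ⟩
        y k      ≤⟨ x≤x⊔y (y k) _ ⟩
        ∣ y k ∣  ∎))
    }
    where
    ≤-by : ∀ {d} {x y : Vector ℝ d} → (∀ k → ∃ λ l → ∣ x k ∣ ≤ ∣ y l ∣) → maxNorm x ≤ maxNorm y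
    ≤-by {x = x} {y} dominated = maxNorm-least x (0≤maxNorm y)
      λ k → ≤-trans (proj₂ (dominated k)) (∣xₖ∣≤maxNorm y _)

  -- Sorting nonnegative vectors.

  ∃-argmax : ∀ {d} (x : Vector ℝ (suc d)) → ∃ λ k → ∀ i → x i ≤ x k
  ∃-argmax {zero}  x = fzero , λ { fzero → ≤-refl }
  ∃-argmax {suc d} x with ∃-argmax (x ∘ fsuc)
  ... | k , max with total (x fzero) (x (fsuc k))
  ...   | inj₁ x₀≤xₖ = fsuc k , λ { fzero → x₀≤xₖ ; (fsuc i) → max i }
  ...   | inj₂ xₖ≤x₀ = fzero  , λ { fzero → ≤-refl ; (fsuc i) → ≤-trans (max i) xₖ≤x₀ }

  -- Beyond the rank d, z is padded by zeros.
  record Sorting {d} (x : Vector ℝ d) : Set where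
    field
      z        : ℕ → ℝ
      π        : Permutation′ d
      sorted   : ∀ k → x k ≈ z (toℕ (π ⟨$⟩ʳ k))
      nonNeg   : ∀ n → 0# ≤ z n
      antitone : ∀ n → z (suc n) ≤ z n
      bounded  : ∀ {u} → 0# ≤ u → (∀ k → x k ≤ u) → z 0 ≤ u

    antitone* : ∀ {m n} → m ℕ.≤ n → z n ≤ z m
    antitone* = go ∘ ℕ.≤⇒≤′
      where
      go : ∀ {m n} → m ℕ.≤′ n → z n ≤ z m
      go ℕ.≤′-refl       = ≤-refl
      go (ℕ.≤′-step m≤n) = ≤-trans (antitone _) (go m≤n)

  -- Selection sort: a largest coordinate gets rank 0. The field `bounded` of the recursive result
  -- is what puts the remaining ranks below it.
  sort : ∀ {d} (x : Vector ℝ d) → x ∈ NonNegOrthant → Sorting x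
  sort {zero}  x 0≤x = record
    { z = λ _ → 0# ; π = Perm.id ; sorted = λ () ; nonNeg = λ _ → ≤-refl
    ; antitone = λ _ → ≤-refl ; bounded = λ 0≤u _ → 0≤u }
  sort {suc d} x 0≤x with ∃-argmax x
  ... | i , max = record
    { z        = z
    ; π        = insert i fzero S.π
    ; sorted   = sorted
    ; nonNeg   = λ { zero → 0≤x i ; (suc n) → S.nonNeg n }
    ; antitone = λ { zero → S.bounded (0≤x i) (λ k → max (punchIn i k)) ; (suc n) → S.antitone n }
    ; bounded  = λ _ x≤u → x≤u i
    }
    where
    module S = Sorting (sort (x ∘ punchIn i) (0≤x ∘ punchIn i))
    z : ℕ → ℝ
    z zero    = x i
    z (suc n) = S.z n
    sorted : ∀ k → x k ≈ z (toℕ (insert i fzero S.π ⟨$⟩ʳ k))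
    sorted k with i Fin.≟ k
    ... | yes ≡.refl = refl
    ... | no  i≢k    = trans (reflexive (≡.cong x (≡.sym (Fin.punchIn-punchOut i≢k))))
                             (S.sorted (punchOut i≢k))

  -- Inequalities for symmetric monotonic norms, and the dilation of ranks.

  transpose-matchˡ : ∀ {d} (i k : Fin d) → Perm.transpose i k ⟨$⟩ʳ i ≡ k
  transpose-matchˡ i k with i Fin.≟ i
  ... | yes _  = ≡.refl
  ... | no i≢i = contradiction ≡.refl i≢i

  sum-nonNeg : ∀ {n} (x : Vector ℝ n) → (∀ i → 0# ≤ x i) → 0# ≤ sum x
  sum-nonNeg {zero}  x 0≤x = ≤-refl
  sum-nonNeg {suc n} x 0≤x = ≤-trans (≤-reflexive (sym (+-identityˡ 0#)))
    (+-mono-≤ (0≤x fzero) (sum-nonNeg (x ∘ fsuc) (0≤x ∘ fsuc)))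

  xₖ≤sum : ∀ {n} (x : Vector ℝ n) → (∀ i → 0# ≤ x i) → ∀ k → x k ≤ sum x
  xₖ≤sum x 0≤x fzero = begin
    x fzero                      ≈⟨ +-identityʳ _ ⟨
    x fzero + 0#                 ≤⟨ +-mono-≤ ≤-refl (sum-nonNeg (x ∘ fsuc) (0≤x ∘ fsuc)) ⟩
    x fzero + sum (x ∘ fsuc)     ∎
  xₖ≤sum x 0≤x (fsuc k) = begin
    x (fsuc k)                   ≈⟨ +-identityˡ _ ⟨
    0# + x (fsuc k)              ≤⟨ +-mono-≤ (0≤x fzero) (xₖ≤sum (x ∘ fsuc) (0≤x ∘ fsuc) k) ⟩
    x fzero + sum (x ∘ fsuc)     ∎

  1ᵥ : ∀ {d} → Vector ℝ d
  1ᵥ {d} = replicate d 1#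

  module _ {d} {f : Vector ℝ d → ℝ} (fNorm : IsSymmetricMonotonicNorm f) where

    open IsSymmetricMonotonicNorm fNorm

    scale : ∀ {c} x → 0# ≤ c → f (map (c *_) x) ≈ c * f x
    scale {c} x 0≤c = trans (homogeneous c x) (*-congʳ (0≤x⇒∣x∣≈x 0≤c))

    f[sum]≤ : ∀ {m} (w : Fin m → Vector ℝ d) {B} → (∀ u → f (w u) ≤ B) →
      f (λ k → sum (λ u → w u k)) ≤ fromℕ m * B
    f[sum]≤ {zero}  w {B} w≤B = begin
      f 0ᵥ                 ≈⟨ cong (λ _ → zeroˡ 0#) ⟨
      f (map (0# *_) 0ᵥ)   ≈⟨ scale 0ᵥ ≤-refl ⟩
      0# * f 0ᵥ            ≈⟨ trans (zeroˡ _) (sym (zeroˡ B)) ⟩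
      0# * B               ∎
    f[sum]≤ {suc m} w {B} w≤B = begin
      f (λ k → sum (λ u → w u k))               ≤⟨ triangle _ _ ⟩
      f (w fzero) + f (λ k → sum (λ u → w (fsuc u) k)) ≤⟨ +-mono-≤ (w≤B fzero) (f[sum]≤ (w ∘ fsuc) (w≤B ∘ fsuc)) ⟩
      B + fromℕ m * B                           ≈⟨ +-congʳ (*-identityˡ B) ⟨
      1# * B + fromℕ m * B                      ≈⟨ distribʳ B 1# (fromℕ m) ⟨
      fromℕ (suc m) * B                         ∎

    -- Every coordinate of the sum of the x ∘ (i k), over all i, is at least xₖ.
    xₖ*f[1]≤d*f[x] : ∀ {x} → x ∈ NonNegOrthant → ∀ k → x k * f 1ᵥ ≤ fromℕ d * f x
    xₖ*f[1]≤d*f[x] {x} 0≤x k = begin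
      x k * f 1ᵥ             ≈⟨ scale 1ᵥ (0≤x k) ⟨
      f (map (x k *_) 1ᵥ)    ≤⟨ monotonic (λ _ → *-nonNeg (0≤x k) 0≤1) dominated ⟩
      f (λ j → sum (λ i → x (Perm.transpose i k ⟨$⟩ʳ j)))
        ≤⟨ f[sum]≤ (λ i → x ∘ (Perm.transpose i k ⟨$⟩ʳ_)) (λ i → ≤-reflexive (symmetric (Perm.transpose i k) x)) ⟩
      fromℕ d * f x          ∎
      where
      dominated : ∀ j → x k * 1# ≤ sum (λ i → x (Perm.transpose i k ⟨$⟩ʳ j))
      dominated j = begin
        x k * 1#                              ≈⟨ *-identityʳ (x k) ⟩
        x k                                   ≡⟨ ≡.cong x (transpose-matchˡ j k) ⟨
        x (Perm.transpose j k ⟨$⟩ʳ j)         ≤⟨ xₖ≤sum _ (λ i → 0≤x (Perm.transpose i k ⟨$⟩ʳ j)) j ⟩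
        sum (λ i → x (Perm.transpose i k ⟨$⟩ʳ j)) ∎

    f[x]≤u*f[1] : ∀ {x u} → x ∈ NonNegOrthant → 0# ≤ u → (∀ k → x k ≤ u) → f x ≤ u * f 1ᵥ
    f[x]≤u*f[1] {x} {u} 0≤x 0≤u x≤u = begin
      f x                  ≤⟨ monotonic 0≤x (λ k → ≤-trans (x≤u k) (≤-reflexive (sym (*-identityʳ u)))) ⟩
      f (map (u *_) 1ᵥ)    ≈⟨ scale 1ᵥ 0≤u ⟩
      u * f 1ᵥ             ∎

    0<f[1] : .{{_ : NonZero d}} → 0# < f 1ᵥ
    0<f[1] = nonNeg 1ᵥ , λ 0≈f[1] → 1≉0 (definite (sym 0≈f[1]) (index d))
      where
      index : ∀ n → .{{_ : NonZero n}} → Fin n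
      index (suc n) = fzero

    -- The ranks are coloured with T + 1 colours such that each of them misses
    -- exactly one colour.  The restriction of the dilated vector to a colour is
    -- dominated by a permutation of the original one.
    module _ (T : ℕ) (z : ℕ → ℝ) (0≤z : ∀ n → 0# ≤ z n)
             (z-antitone : ∀ {m n} → m ℕ.≤ n → z n ≤ z m) where

      private
        q : ℕ
        q = suc T

        -- The truncated difference is 0 when `q` divides `suc n` and 1 otherwise. Rank n has colour
        -- u when the value at n + u is 1.
        coloured : ℕ → ℕ
        coloured n = suc (n / q) ℕ.∸ suc n / q

      -- Each summand is 1 minus an increment of the quotient by `q`, so the sum telescopes. The
      -- quotients are arranged so that only additions occur.
      sum-coloured : ∀ m n → sum {m} (λ u → fromℕ (coloured (n ℕ.+ toℕ u))) + fromℕ ((n ℕ.+ m) / q)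
                             ≈ fromℕ m + fromℕ (n / q)
      sum-coloured zero    n =
        +-congˡ (reflexive (≡.cong (λ l → fromℕ (l / q)) (ℕ.+-identityʳ n)))
      sum-coloured (suc m) n = begin-equality
        (c (n ℕ.+ 0) + S (λ u → n ℕ.+ suc (toℕ u))) + fromℕ ((n ℕ.+ suc m) / q)
          ≡⟨ ≡.cong₂ _+_ (≡.cong₂ _+_ (≡.cong c (ℕ.+-identityʳ n))
                            (sum-cong-≗ {m} (λ u → ≡.cong c (ℕ.+-suc n (toℕ u)))))
                         (≡.cong (λ l → fromℕ (l / q)) (ℕ.+-suc n m)) ⟩
        (c n + S (λ u → suc n ℕ.+ toℕ u)) + fromℕ ((suc n ℕ.+ m) / q)
          ≈⟨ +-assoc _ _ _ ⟩
        c n + (S (λ u → suc n ℕ.+ toℕ u) + fromℕ ((suc n ℕ.+ m) / q))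
          ≈⟨ +-congˡ (sum-coloured m (suc n)) ⟩
        c n + (fromℕ m + fromℕ (suc n / q))
          ≈⟨ solve 3 (λ a b c → a :+ (b :+ c) := b :+ (a :+ c)) refl (c n) (fromℕ m) _ ⟩
        fromℕ m + (c n + fromℕ (suc n / q))
          ≈⟨ +-congˡ (×-homo-+ 1# (coloured n) (suc n / q)) ⟨
        fromℕ m + fromℕ (coloured n ℕ.+ suc n / q)
          ≡⟨ ≡.cong (λ l → fromℕ m + fromℕ l) (ℕ.m∸n+n≡m ([1+n]/d≤1+n/d n q)) ⟩
        fromℕ m + (1# + fromℕ (n / q))
          ≈⟨ solve 3 (λ a b c → a :+ (b :+ c) := (b :+ a) :+ c) refl (fromℕ m) 1# _ ⟩
        fromℕ (suc m) + fromℕ (n / q)  ∎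
        where
        c : ℕ → ℝ
        c n = fromℕ (coloured n)
        S : (Fin m → ℕ) → ℝ
        S l = sum (c ∘ l)

      sum-colours : ∀ n → sum {q} (λ u → fromℕ (coloured (n ℕ.+ toℕ u))) ≈ fromℕ T
      sum-colours n = +-cancelʳ (fromℕ (suc (n / q))) _ _ (begin-equality
        S + fromℕ (suc (n / q))      ≡⟨ ≡.cong (λ l → S + fromℕ l) ([n+d]/d n q) ⟨
        S + fromℕ ((n ℕ.+ q) / q)    ≈⟨ sum-coloured q n ⟩
        fromℕ q + fromℕ (n / q)
          ≈⟨ solve 3 (λ a b c → (a :+ b) :+ c := b :+ (a :+ c)) refl 1# (fromℕ T) (fromℕ (n / q)) ⟩
        fromℕ T + fromℕ (suc (n / q)) ∎)
        where S = sum {q} (λ u → fromℕ (coloured (n ℕ.+ toℕ u)))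

      -- At each rank the factor `T` is written as the number of its colours. This splits the vector
      -- into `q` parts, to which the triangle inequality applies.
      dilation : (s : Fin d → ℕ) → (∀ k → toℕ k ℕ.≤ s k ℕ.+ toℕ k / q) →
        fromℕ T * f (z ∘ s) ≤ fromℕ q * f (z ∘ toℕ)
      dilation s k≤s = begin
        fromℕ T * f (z ∘ s)                ≈⟨ scale (z ∘ s) (0≤fromℕ T) ⟨
        f (map (fromℕ T *_) (z ∘ s))       ≈⟨ cong (λ k → trans (*-congʳ (sym (sum-colours (toℕ k))))
                                                                (*-distribʳ-sum (z (s k)) (weight k))) ⟩
        f (λ k → sum (λ u → w u k))        ≤⟨ f[sum]≤ w w≤ ⟩
        fromℕ q * f (z ∘ toℕ)              ∎
        where
        weight : Fin d → Vector ℝ q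
        weight k u = fromℕ (coloured (toℕ k ℕ.+ toℕ u))

        w : Fin q → Vector ℝ d
        w u k = weight k u * z (s k)

        w≤ : ∀ u → f (w u) ≤ f (z ∘ toℕ)
        w≤ u with compress d (λ n → (n ℕ.+ toℕ u) / q) (λ n → [1+n]/d≤1+n/d (n ℕ.+ toℕ u) q)
        ... | π , bound = begin
          f (w u)                     ≤⟨ monotonic 0≤w dominated ⟩
          f (z ∘ toℕ ∘ (π ⟨$⟩ʳ_))     ≈⟨ symmetric π (z ∘ toℕ) ⟩
          f (z ∘ toℕ)                 ∎
          where
          0≤w : w u ∈ NonNegOrthant
          0≤w k = *-nonNeg (0≤fromℕ (coloured (toℕ k ℕ.+ toℕ u))) (0≤z (s k))

          dominated : ∀ k → w u k ≤ z (toℕ (π ⟨$⟩ʳ k))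
          dominated k with suc (toℕ k ℕ.+ toℕ u) / q ℕ.≟ (toℕ k ℕ.+ toℕ u) / q
          ... | yes same = begin
            fromℕ (suc h ℕ.∸ h′) * z (s k) ≡⟨ ≡.cong (λ l → fromℕ (suc h ℕ.∸ l) * z (s k)) same ⟩
            fromℕ (suc h ℕ.∸ h) * z (s k)  ≡⟨ ≡.cong (λ l → fromℕ l * z (s k)) (ℕ.m+n∸n≡m 1 h) ⟩
            fromℕ 1 * z (s k)              ≈⟨ *-congʳ (+-identityʳ 1#) ⟩
            1# * z (s k)                   ≈⟨ *-identityˡ _ ⟩
            z (s k)                        ≤⟨ z-antitone (ℕ.+-cancelʳ-≤ h _ _ πk+h≤sk+h) ⟩
            z (toℕ (π ⟨$⟩ʳ k))             ∎
            where
            h  = (toℕ k ℕ.+ toℕ u) / q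
            h′ = suc (toℕ k ℕ.+ toℕ u) / q
            -- The jumps below rank k number (k + u) / q, since u / q is 0; this is at least k / q,
            -- the rounding error allowed by `k≤s`. So `π` brings k to a rank at most `s k`.
            πk+h≤sk+h : toℕ (π ⟨$⟩ʳ k) ℕ.+ h ℕ.≤ s k ℕ.+ h
            πk+h≤sk+h = ℕ.≤-trans (bound k same) (ℕ.≤-trans
              (ℕ.≤-reflexive (≡.trans (≡.cong (toℕ k ℕ.+_) (m<n⇒m/n≡0 (Fin.toℕ<n u))) (ℕ.+-identityʳ _)))
              (ℕ.≤-trans (k≤s k) (ℕ.+-monoʳ-≤ (s k) (/-monoˡ-≤ q (ℕ.m≤m+n (toℕ k) (toℕ u))))))
          ... | no jump = begin
            fromℕ (suc h ℕ.∸ h′) * z (s k) ≡⟨ ≡.cong (λ l → fromℕ l * z (s k)) (ℕ.m≤n⇒m∸n≡0 h<h′) ⟩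
            0# * z (s k)                   ≈⟨ zeroˡ _ ⟩
            0#                             ≤⟨ 0≤z _ ⟩
            z (toℕ (π ⟨$⟩ʳ k))             ∎
            where
            h  = (toℕ k ℕ.+ toℕ u) / q
            h′ = suc (toℕ k ℕ.+ toℕ u) / q
            h<h′ : h ℕ.< h′
            h<h′ = ℕ.≤∧≢⇒< (/-monoˡ-≤ q (ℕ.n≤1+n _)) (jump ∘ ≡.sym)

  -- Covering antitone sequences by lattice paths.

  -- Cells are closed, so neighbours share an endpoint and `total` suffices to place a value.
  SameCell : (ℕ → ℝ) → ℝ → ℝ → Set
  SameCell v s t = ∃ λ b → (v b ≤ s × s ≤ v (suc b)) × (v b ≤ t × t ≤ v (suc b))

  module _ {I : Set} (v : ℕ → ℝ) where

    -- The representative must lie in `P` as well, because the recursion records in `P` the bounds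
    -- already imposed on the entries.
    Covers : (I → ℕ → ℝ) → ℕ → Pred I 0ℓ → List I → Set
    Covers a n P X = ∀ {i} → i ∈ P → ∃ λ i′ → i′ ∈ₗ X × i′ ∈ P ×
      (∀ {j} → j ℕ.< n → SameCell v (a i j) (a i′ j))

    -- An antitone sequence of n cells with indices at most m is a lattice path
    -- with n + m steps: its first cell is m, or all its cells are below m.
    cover : (a : I → ℕ → ℝ) → (∀ i j → a i (suc j) ≤ a i j) → (∀ i j → v 0 ≤ a i j) →
      ∀ n m (P : Pred I 0ℓ) → (∀ {i} → i ∈ P → a i 0 ≤ v (suc m)) →
      ∃ λ X → length X ℕ.≤ 2 ℕ.^ (n ℕ.+ m) × Covers a n P X

    -- The first entry lies in cell m. By antitonicity the tail keeps the same upper bound, so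
    -- removing this entry is a path step in n only.
    cover-top : (a : I → ℕ → ℝ) → (∀ i j → a i (suc j) ≤ a i j) → (∀ i j → v 0 ≤ a i j) →
      ∀ n m (P : Pred I 0ℓ) → (∀ {i} → i ∈ P → a i 0 ≤ v (suc m)) →
      ∃ λ X → length X ℕ.≤ 2 ℕ.^ (n ℕ.+ m) × Covers a (suc n) (λ i → i ∈ P × v m ≤ a i 0) X

    cover-top a a-antitone v₀≤a n m P a≤v with
      cover (λ i → a i ∘ suc) (λ i → a-antitone i ∘ suc) (λ i → v₀≤a i ∘ suc) n m
        (λ i → i ∈ P × v m ≤ a i 0) (λ { (i∈P , _) → ≤-trans (a-antitone _ 0) (a≤v i∈P) })
    ... | X , ∣X∣≤ , covered = X , ∣X∣≤ , extend
      where
      extend : Covers a (suc n) (λ i → i ∈ P × v m ≤ a i 0) X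
      extend {i} (i∈P , vₘ≤a) with covered (i∈P , vₘ≤a)
      ... | i′ , i′∈X , (i′∈P , vₘ≤a′) , same = i′ , i′∈X , (i′∈P , vₘ≤a′) , same-suc
        where
        same-suc : ∀ {j} → j ℕ.< suc n → SameCell v (a i j) (a i′ j)
        same-suc {zero}  _         = m , (vₘ≤a , a≤v i∈P) , (vₘ≤a′ , a≤v i′∈P)
        same-suc {suc j} (s≤s j<n) = same j<n

    -- No entry is left to compare, so any one member of `P` represents all; excluded middle tells
    -- whether there is one.
    cover a a-antitone v₀≤a zero m P a≤v with em {∃ P}
    ... | yes (i , i∈P) = i List.∷ List.[] , ℕ.>-nonZero⁻¹ _ {{ℕ.m^n≢0 2 m}} ,
                          λ _ → i , here ≡.refl , i∈P , λ ()
    ... | no  P-empty   = List.[] , z≤n , λ i∈P → contradiction (_ , i∈P) P-empty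
    -- With m = 0 the lower bound `v 0` puts every first entry into the top cell, so there is no
    -- second branch.
    cover a a-antitone v₀≤a (suc n) zero P a≤v with cover-top a a-antitone v₀≤a n zero P a≤v
    ... | X , ∣X∣≤ , covered = X , ℕ.≤-trans ∣X∣≤ (ℕ.m≤m+n _ _) , λ i∈P →
      let i′ , i′∈X , (i′∈P , _) , same = covered (i∈P , v₀≤a _ 0) in i′ , i′∈X , i′∈P , same
    cover a a-antitone v₀≤a (suc n) (suc m) P a≤v
      with cover-top a a-antitone v₀≤a n (suc m) P a≤v
         | cover a a-antitone v₀≤a (suc n) m (λ i → i ∈ P × a i 0 ≤ v (suc m)) proj₂
    ... | X , ∣X∣≤ , coveredX | Y , ∣Y∣≤ , coveredY = X List.++ Y , ∣X++Y∣≤ , covered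
      where
      ∣X++Y∣≤ : length (X List.++ Y) ℕ.≤ 2 ℕ.^ (suc n ℕ.+ suc m)
      ∣X++Y∣≤ = ℕ.≤-trans (ℕ.≤-reflexive (List.length-++ X)) (ℕ.+-mono-≤ ∣X∣≤ (ℕ.≤-trans ∣Y∣≤
        (ℕ.≤-reflexive (≡.trans (≡.cong (2 ℕ.^_) (≡.sym (ℕ.+-suc n m))) (≡.sym (ℕ.+-identityʳ _))))))
      covered : Covers a (suc n) P (X List.++ Y)
      covered {i} i∈P with total (v (suc m)) (a i 0)
      ... | inj₁ vₘ≤a = let i′ , i′∈X , (i′∈P , _) , same = coveredX (i∈P , vₘ≤a)
                        in i′ , ∈-++⁺ˡ i′∈X , i′∈P , same
      ... | inj₂ a≤vₘ = let i′ , i′∈Y , (i′∈P , _) , same = coveredY (i∈P , a≤vₘ)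
                        in i′ , ∈-++⁺ʳ X i′∈Y , i′∈P , same

  -- Rounding values and ranks together.

  -- In place of dividing by d * T, both sides are multiplied by it: `level` has unit μ and `sample`
  -- carries the factor. No separate case μ = 0 arises.
  level : (T : ℕ) .{{_ : NonZero T}} → ℝ → ℕ → ℝ
  level T μ b = fromℕ (grid T b) * μ

  sample : ∀ {d} (T : ℕ) .{{_ : NonZero T}} {x : Vector ℝ d} → Sorting x → ℕ → ℝ
  sample {d} T S j = fromℕ (d ℕ.* T) * Sorting.z S (grid T j)

  module _ {d : ℕ} (T : ℕ) .{{_ : NonZero T}} {μ : ℝ} (0≤μ : 0# ≤ μ) where

    private
      t = fromℕ T
      δ = fromℕ d
      q = fromℕ (suc T)

    -- With unit μ/(dT), a cell [grid b, grid (b + 1)] has relative width 1/T up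
    -- to an additive error of one unit.
    cell-width : ∀ {y y′} → SameCell (level T μ) (fromℕ (d ℕ.* T) * y) (fromℕ (d ℕ.* T) * y′) →
      (δ * t) * y′ ≤ (δ * q) * y + μ
    cell-width {y} {y′} (b , (v≤y , _) , (_ , y′≤v)) = *-cancelˡ-≤ (0<fromℕ T) (begin
      t * ((δ * t) * y′)                  ≈⟨ *-congˡ (*-congʳ (×1-homo-* d T)) ⟨
      t * (fromℕ (d ℕ.* T) * y′)          ≤⟨ *-monoʳ-≤ (0≤fromℕ T) y′≤v ⟩
      t * (fromℕ (grid T (suc b)) * μ)    ≈⟨ *-assoc _ _ _ ⟨
      (t * fromℕ (grid T (suc b))) * μ    ≈⟨ *-congʳ (×1-homo-* T (grid T (suc b))) ⟨
      fromℕ (T ℕ.* grid T (suc b)) * μ    ≤⟨ *-mono-≤ (0≤fromℕ (T ℕ.* grid T (suc b))) 0≤μ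
                                               (fromℕ-mono (grid-step T b)) ≤-refl ⟩
      fromℕ (suc T ℕ.* grid T b ℕ.+ T) * μ ≈⟨ *-congʳ (trans (×-homo-+ 1# (suc T ℕ.* grid T b) T)
                                                             (+-congʳ (×1-homo-* (suc T) (grid T b)))) ⟩
      (q * fromℕ (grid T b) + t) * μ      ≈⟨ solve 4 (λ q g t m → (q :* g :+ t) :* m := q :* (g :* m) :+ t :* m)
                                               refl q (fromℕ (grid T b)) t μ ⟩
      q * level T μ b + t * μ             ≤⟨ +-monoˡ-≤ (t * μ) (*-monoʳ-≤ (0≤fromℕ (suc T)) v≤y) ⟩
      q * (fromℕ (d ℕ.* T) * y) + t * μ   ≈⟨ +-congʳ (*-congˡ (*-congʳ (×1-homo-* d T))) ⟩
      q * ((δ * t) * y) + t * μ           ≈⟨ solve 5 (λ q d t y m → q :* ((d :* t) :* y) :+ t :* m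
                                                                  := t :* ((d :* q) :* y :+ m))
                                               refl q δ t y μ ⟩
      t * ((δ * q) * y + μ)               ∎)

    module _ {f : Vector ℝ d → ℝ} (fNorm : IsSymmetricMonotonicNorm f) where

      open IsSymmetricMonotonicNorm fNorm

      -- Divided by `t * t`, the factor is (1 + 1/T)² + 1/T. With y the sorted x at rounded ranks,
      -- `dilation` compares f y with f x, `cell-width` compares x′ with y, and the extra unit per
      -- coordinate costs f x / T.
      same-cells⇒f-close : .{{_ : NonZero d}} → ∀ n → d ℕ.≤ grid T n →
        ∀ {x x′} (S : Sorting x) (S′ : Sorting x′) →
        μ * f 1ᵥ ≤ δ * f x →
        (∀ {j} → j ℕ.< n → SameCell (level T μ) (sample T S j) (sample T S′ j)) →
        (t * t) * f x′ ≤ (q * q + t) * f x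
      same-cells⇒f-close n d≤gₙ {x} {x′} S S′ μ*f[1]≤d*f[x] same = begin
        (t * t) * f x′             ≈⟨ *-assoc t t (f x′) ⟩
        t * (t * f x′)             ≤⟨ *-monoʳ-≤ (0≤fromℕ T) (*-cancelˡ-≤ (0<fromℕ d) δtf[x′]≤) ⟩
        t * (q * f y + f x)        ≈⟨ solve 4 (λ t q y x → t :* (q :* y :+ x) := q :* (t :* y) :+ t :* x)
                                        refl t q (f y) (f x) ⟩
        q * (t * f y) + t * f x    ≤⟨ +-monoˡ-≤ _ (*-monoʳ-≤ (0≤fromℕ (suc T)) tf[y]≤qf[x]) ⟩
        q * (q * f x) + t * f x    ≈⟨ solve 3 (λ t q x → q :* (q :* x) :+ t :* x := (q :* q :+ t) :* x)
                                        refl t q (f x) ⟩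
        (q * q + t) * f x          ∎
        where
        module S  = Sorting S
        module S′ = Sorting S′

        locate : ∀ k → _
        locate k = grid-locate T n {toℕ k} (ℕ.≤-trans (Fin.toℕ<n {d} k) d≤gₙ)

        y : Vector ℝ d
        y k = S.z (grid T (proj₁ (locate k)))

        f[z]≈f[x] : ∀ {x} (S : Sorting x) → f (Sorting.z S ∘ toℕ) ≈ f x
        f[z]≈f[x] {x} S = trans (sym (symmetric π (z ∘ toℕ))) (cong (sym ∘ sorted))
          where open Sorting S

        tf[y]≤qf[x] : t * f y ≤ q * f x
        tf[y]≤qf[x] = ≤-trans
          (dilation fNorm T S.z S.nonNeg S.antitone* _ λ k →
            let j , _ , lb , ub = locate k in grid-gap T j lb ub)
          (≤-reflexive (*-congˡ (f[z]≈f[x] S)))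

        0≤δt : 0# ≤ δ * t
        0≤δt = *-nonNeg (0≤fromℕ d) (0≤fromℕ T)

        -- Rounding the ranks of `x′` costs nothing: `S′.z` at rank k is at most its value at the
        -- grid rank at or below k, where `x` and `x′` share a cell.
        δtz′≤ : ∀ k → (δ * t) * S′.z (toℕ k) ≤ (δ * q) * y k + μ * 1#
        δtz′≤ k = begin
          (δ * t) * S′.z (toℕ k)      ≤⟨ *-monoʳ-≤ 0≤δt (S′.antitone* (proj₁ (proj₂ (proj₂ (locate k))))) ⟩
          (δ * t) * S′.z (grid T (proj₁ (locate k))) ≤⟨ cell-width (same (proj₁ (proj₂ (locate k)))) ⟩
          (δ * q) * y k + μ           ≈⟨ +-congˡ (*-identityʳ μ) ⟨
          (δ * q) * y k + μ * 1#      ∎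

        δtf[x′]≤ : δ * (t * f x′) ≤ δ * (q * f y + f x)
        δtf[x′]≤ = begin
          δ * (t * f x′)               ≈⟨ *-assoc δ t (f x′) ⟨
          (δ * t) * f x′               ≈⟨ *-congˡ (f[z]≈f[x] S′) ⟨
          (δ * t) * f (S′.z ∘ toℕ)     ≈⟨ scale fNorm (S′.z ∘ toℕ) 0≤δt ⟨
          f (map ((δ * t) *_) (S′.z ∘ toℕ))
            ≤⟨ monotonic (λ k → *-nonNeg 0≤δt (S′.nonNeg (toℕ k))) δtz′≤ ⟩
          f (zipWith _+_ (map ((δ * q) *_) y) (map (μ *_) 1ᵥ)) ≤⟨ triangle _ _ ⟩
          f (map ((δ * q) *_) y) + f (map (μ *_) 1ᵥ)
            ≈⟨ +-cong (scale fNorm y (*-nonNeg (0≤fromℕ d) (0≤fromℕ (suc T)))) (scale fNorm 1ᵥ 0≤μ) ⟩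
          (δ * q) * f y + μ * f 1ᵥ   ≤⟨ +-mono-≤ ≤-refl μ*f[1]≤d*f[x] ⟩
          (δ * q) * f y + δ * f x      ≈⟨ solve 4 (λ d q y x → (d :* q) :* y :+ d :* x := d :* (q :* y :+ x))
                                            refl δ q (f y) (f x) ⟩
          δ * (q * f y + f x)          ∎

  -- From approximate minimizers to portfolios.

  ∈⇒minimum : ∀ {d} (f : Vector ℝ d → ℝ) {X x} → x ∈ₗ X → ∃ λ m → IsMinimum f (_∈ₗ X) m × m ≤ f x
  ∈⇒minimum f {X} {x} x∈X =
    f (argmin f x X) ,
    ((argmin f x X , argmin∈X , refl) , All.lookup (f[argmin]≤f[xs] x X)) ,
    f[argmin]≤f[⊤] {f = f} x X
    where
    open Extrema totalOrder using (argmin; argmin-sel; f[argmin]≤f[⊤]; f[argmin]≤f[xs])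
    argmin∈X : argmin f x X ∈ₗ X
    argmin∈X with argmin-sel f x X
    ... | inj₁ eq = ≡.subst (_∈ₗ X) (≡.sym eq) x∈X
    ... | inj₂ h  = h

  -- Only exact minimizers over D have to be approximated, so bounds that hold for minimizers alone,
  -- such as `minimizer-bounded`, may be used.
  portfolio : ∀ {d α} {D : Pred (Vector ℝ d) 0ℓ} {X} →
    (∀ f → IsSymmetricMonotonicNorm f → AttainsMinimum f D) → (∀ {x} → x ∈ₗ X → x ∈ D) →
    (∀ {f} → IsSymmetricMonotonicNorm f → ∀ {x} → x ∈ D → (∀ {y} → y ∈ D → f x ≤ f y) →
      ∃ λ x′ → x′ ∈ₗ X × f x′ ≤ α * f x) →
    IsPortfolio α IsSymmetricMonotonicNorm D (_∈ₗ X)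
  portfolio attains X⊆D approx = record
    { subset      = X⊆D
    ; approximate = λ {f} fNorm →
        let m* , (x , x∈D , fx≈m*) , m*-min = attains f fNorm
            x′ , x′∈X , fx′≤αfx             = approx fNorm x∈D (λ y∈D → ≤-trans (≤-reflexive fx≈m*) (m*-min y∈D))
            m , m-isMin , m≤fx′             = ∈⇒minimum f x′∈X
        in m , m* , m-isMin , ((x , x∈D , fx≈m*) , m*-min) ,
           ≤-trans m≤fx′ (≤-trans fx′≤αfx (≤-reflexive (*-congˡ fx≈m*)))
    }

  x≤[1+ε]x : ∀ {x ε} → 0# ≤ ε → 0# ≤ x → x ≤ (1# + ε) * x
  x≤[1+ε]x {x} {ε} 0≤ε 0≤x = begin
    x                  ≈⟨ *-identityˡ x ⟨
    1# * x             ≈⟨ +-identityʳ _ ⟨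
    1# * x + 0#        ≤⟨ +-mono-≤ ≤-refl (*-nonNeg 0≤ε 0≤x) ⟩
    1# * x + ε * x     ≈⟨ distribʳ x 1# ε ⟨
    (1# + ε) * x       ∎

  -- Portfolios over a fixed set D.

  module _ {n} {D : Pred (Vector ℝ (suc n)) 0ℓ} (D⊆ℝ≥0 : D ⊆ NonNegOrthant)
           (attains : ∀ f → IsSymmetricMonotonicNorm f → AttainsMinimum f D) where

    private
      d : ℕ
      d = suc n

    μ : ℝ
    μ = proj₁ (attains maxNorm maxNorm-isSymmetricMonotonicNorm)

    private
      μ-isMinimum : IsMinimum maxNorm D μ
      μ-isMinimum = proj₂ (attains maxNorm maxNorm-isSymmetricMonotonicNorm)

      o : Vector ℝ d
      o = proj₁ (proj₁ μ-isMinimum)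

      o∈D : o ∈ D
      o∈D = proj₁ (proj₂ (proj₁ μ-isMinimum))

      maxNorm[o]≈μ : maxNorm o ≈ μ
      maxNorm[o]≈μ = proj₂ (proj₂ (proj₁ μ-isMinimum))

    0≤μ : 0# ≤ μ
    0≤μ = ≤-trans (0≤maxNorm o) (≤-reflexive maxNorm[o]≈μ)

    module _ {f : Vector ℝ d → ℝ} (fNorm : IsSymmetricMonotonicNorm f) where

      f[o]≤μ*f[1] : f o ≤ μ * f 1ᵥ
      f[o]≤μ*f[1] = f[x]≤u*f[1] fNorm (D⊆ℝ≥0 o∈D) 0≤μ λ k →
        ≤-trans (x≤x⊔y (o k) (- o k)) (≤-trans (∣xₖ∣≤maxNorm o k) (≤-reflexive maxNorm[o]≈μ))

      -- The largest coordinate of x is its maximum norm, hence at least μ, and `xₖ*f[1]≤d*f[x]`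
      -- applies to it.
      μ*f[1]≤d*f[x] : ∀ {x} → x ∈ D → μ * f 1ᵥ ≤ fromℕ d * f x
      μ*f[1]≤d*f[x] {x} x∈D with ∃-argmax x
      ... | k , max = ≤-trans
        (*-mono-≤ 0≤μ (IsSymmetricMonotonicNorm.nonNeg fNorm _)
          (≤-trans (proj₂ μ-isMinimum x∈D) (maxNorm-least x (D⊆ℝ≥0 x∈D k) λ i →
            ≤-trans (≤-reflexive (0≤x⇒∣x∣≈x (D⊆ℝ≥0 x∈D i))) (max i)))
          ≤-refl)
        (xₖ*f[1]≤d*f[x] fNorm (D⊆ℝ≥0 x∈D) k)

      -- A minimizer does no worse than `o`, whose norm is at most μ * f 1ᵥ; the positive `f 1ᵥ`
      -- then cancels.
      minimizer-bounded : ∀ {x} → x ∈ D → (∀ {y} → y ∈ D → f x ≤ f y) →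
        ∀ k → x k ≤ fromℕ d * μ
      minimizer-bounded {x} x∈D x-min k = *-cancelˡ-≤ (0<f[1] fNorm) (begin
        f 1ᵥ * x k                ≈⟨ *-comm _ _ ⟩
        x k * f 1ᵥ                ≤⟨ xₖ*f[1]≤d*f[x] fNorm (D⊆ℝ≥0 x∈D) k ⟩
        fromℕ d * f x             ≤⟨ *-monoʳ-≤ (0≤fromℕ d) (≤-trans (x-min o∈D) f[o]≤μ*f[1]) ⟩
        fromℕ d * (μ * f 1ᵥ)      ≈⟨ solve 3 (λ a b c → a :* (b :* c) := c :* (a :* b)) refl (fromℕ d) μ (f 1ᵥ) ⟩
        f 1ᵥ * (fromℕ d * μ)      ∎)

    -- Used for d = 1, where the factor d means exact optimality and powers of d allow only one
    -- vector.
    singleton-portfolio : ∃ λ X → length X ≡ 1 ×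
      (∀ {x} → x ∈ₗ X → x ∈ D) ×
      (∀ {f} → IsSymmetricMonotonicNorm f → ∀ {x} → x ∈ D → ∃ λ x′ → x′ ∈ₗ X × f x′ ≤ fromℕ d * f x)
    singleton-portfolio = o List.∷ List.[] , ≡.refl , (λ { (here ≡.refl) → o∈D }) ,
      λ fNorm x∈D → o , here ≡.refl , ≤-trans (f[o]≤μ*f[1] fNorm) (μ*f[1]≤d*f[x] fNorm x∈D)

    module _ (T : ℕ) .{{_ : NonZero T}} (l : ℕ) (d≤2^l : d ℕ.≤ 2 ℕ.^ l) where

      private
        m : ℕ
        m = (2 ℕ.* l) ℕ.* T ℕ.+ T

        -- Indices carry membership proofs, from which `sort` gets nonnegativity and the portfolio
        -- its inclusion in D.
        sorting : (i : ∃ D) → Sorting (proj₁ i)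
        sorting (x , x∈D) = sort x (D⊆ℝ≥0 x∈D)

        a : ∃ D → ℕ → ℝ
        a i = sample T (sorting i)

        a-antitone : ∀ i j → a i (suc j) ≤ a i j
        a-antitone i j = *-monoʳ-≤ (0≤fromℕ (d ℕ.* T))
          (Sorting.antitone* (sorting i) (ℕ.m≤n⇒m≤1+n (ℕ.m≤m+n (grid T j) _)))

        v₀≤a : ∀ i j → level T μ 0 ≤ a i j
        v₀≤a i j = ≤-trans (≤-reflexive (zeroˡ μ))
          (*-nonNeg (0≤fromℕ (d ℕ.* T)) (Sorting.nonNeg (sorting i) (grid T j)))

        -- Minimizers of all the norms satisfy this, and it does not mention the norm; so one cover
        -- serves the whole class.
        Bounded : Pred (∃ D) 0ℓ
        Bounded (x , _) = ∀ k → x k ≤ fromℕ d * μ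

        a≤v : ∀ {i} → i ∈ Bounded → a i 0 ≤ level T μ (suc m)
        a≤v {i} x≤dμ = begin
          fromℕ (d ℕ.* T) * Sorting.z (sorting i) 0
            ≤⟨ *-monoʳ-≤ (0≤fromℕ (d ℕ.* T)) (Sorting.bounded (sorting i) (*-nonNeg (0≤fromℕ d) 0≤μ) x≤dμ) ⟩
          fromℕ (d ℕ.* T) * (fromℕ d * μ)   ≈⟨ *-assoc _ _ _ ⟨
          (fromℕ (d ℕ.* T) * fromℕ d) * μ   ≈⟨ *-congʳ (×1-homo-* (d ℕ.* T) d) ⟨
          fromℕ (d ℕ.* T ℕ.* d) * μ
            ≤⟨ *-mono-≤ (0≤fromℕ (d ℕ.* T ℕ.* d)) 0≤μ (fromℕ-mono dTd≤grid) ≤-refl ⟩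
          level T μ (suc m)                 ∎
          where
          dTd≤grid : d ℕ.* T ℕ.* d ℕ.≤ grid T (suc m)
          dTd≤grid = ℕ.m≤n⇒m≤1+n (ℕ.≤-trans (n*T*n≤grid[2*l*T+T] T l d≤2^l) (ℕ.m≤m+n _ _))

      grid-portfolio :
        ∃ λ X → length X ℕ.≤ 2 ℕ.^ ((l ℕ.* T ℕ.+ 1) ℕ.+ ((2 ℕ.* l) ℕ.* T ℕ.+ T)) ×
        (∀ {x} → x ∈ₗ X → x ∈ D) ×
        (∀ {f} → IsSymmetricMonotonicNorm f → ∀ {x} → x ∈ D → (∀ {y} → y ∈ D → f x ≤ f y) →
         ∃ λ x′ → x′ ∈ₗ X ×
         (fromℕ T * fromℕ T) * f x′ ≤ (fromℕ (suc T) * fromℕ (suc T) + fromℕ T) * f x)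
      grid-portfolio with cover (level T μ) a a-antitone v₀≤a (l ℕ.* T ℕ.+ 1) m Bounded (λ {i} → a≤v {i})
      ... | X , ∣X∣≤ , covered =
        List.map proj₁ X , ≡.subst (ℕ._≤ _) (≡.sym (List.length-map proj₁ X)) ∣X∣≤ , X⊆D , approx
        where
        X⊆D : ∀ {x} → x ∈ₗ List.map proj₁ X → x ∈ D
        X⊆D x∈X with ∈-map⁻ proj₁ x∈X
        ... | (_ , x∈D) , _ , ≡.refl = x∈D

        approx : ∀ {f} → IsSymmetricMonotonicNorm f → ∀ {x} → x ∈ D → (∀ {y} → y ∈ D → f x ≤ f y) →
          ∃ λ x′ → x′ ∈ₗ List.map proj₁ X ×
          (fromℕ T * fromℕ T) * f x′ ≤ (fromℕ (suc T) * fromℕ (suc T) + fromℕ T) * f x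
        approx fNorm {x} x∈D x-min =
          let (x′ , x′∈D) , x′∈X , _ , same = covered {x , x∈D} (minimizer-bounded fNorm x∈D x-min) in
          x′ , ∈-map⁺ proj₁ x′∈X ,
          same-cells⇒f-close T 0≤μ fNorm (l ℕ.* T ℕ.+ 1) (n≤grid[l*T+1] T l d≤2^l)
            (sorting (x , x∈D)) (sorting (x′ , x′∈D)) (μ*f[1]≤d*f[x] fNorm x∈D) same

  -- Real powers, the size bound and the choice of `T`.

  -- For r = 1/ε the lower bound keeps the exponent of d under control, and the upper one makes `T`
  -- large enough. Both are nonstrict, so descending from an Archimedean bound with `total` finds k.
  floor : ∀ {r} → 1# ≤ r → ∃ λ k → fromℕ (1 ℕ.+ k) ≤ r × r ≤ fromℕ (2 ℕ.+ k)
  floor {r} 1≤r with archimedean r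
  ... | n , r≤n = go n (≤-trans r≤n (fromℕ-mono (ℕ.m≤n+m n 2)))
    where
    go : ∀ n → r ≤ fromℕ (2 ℕ.+ n) → ∃ λ k → fromℕ (1 ℕ.+ k) ≤ r × r ≤ fromℕ (2 ℕ.+ k)
    go zero    r≤2   = 0 , ≤-trans (≤-reflexive (+-identityʳ 1#)) 1≤r , r≤2
    go (suc n) r≤3+n with total (fromℕ (2 ℕ.+ n)) r
    ... | inj₁ 2+n≤r = suc n , 2+n≤r , r≤3+n
    ... | inj₂ r≤2+n = go n r≤2+n

  recip-inverse : ∀ {x} (0<x : 0# < x) → x * recip 0<x ≈ 1#
  recip-inverse 0<x = proj₂ (inverse _ (proj₂ 0<x ∘ sym))

  1≤recip : ∀ {x} (0<x : 0# < x) → x ≤ 1# → 1# ≤ recip 0<x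
  1≤recip {x} 0<x x≤1 = *-cancelˡ-≤ 0<x (begin
    x * 1#           ≈⟨ *-identityʳ x ⟩
    x                ≤⟨ x≤1 ⟩
    1#               ≈⟨ recip-inverse 0<x ⟨
    x * recip 0<x    ∎)

  fromℕ-^ : ∀ m n → fromℕ (m ℕ.^ n) ≈ fromℕ m ^ n
  fromℕ-^ m zero    = +-identityʳ 1#
  fromℕ-^ m (suc n) = trans (×1-homo-* m (m ℕ.^ n)) (*-congˡ (fromℕ-^ m n))

  ^≤power : ∀ {b p} (1≤b : 1# ≤ b) (0≤p : 0# ≤ p) k → fromℕ k ≤ p → b ^ k ≤ power b p 1≤b 0≤p
  ^≤power {b} {p} 1≤b 0≤p k k≤p = proj₁ (proj₂ (supremum (RationalPowersBelow b p)
      (rationalPowersBelow-nonempty 0≤p) (rationalPowersBelow-bounded 1≤b)))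
    (^-nonNeg k (≤-trans 0≤1 1≤b) , k , 1 , _ ,
     ≤-trans k≤p (≤-reflexive (sym (trans (*-congʳ (+-identityʳ 1#)) (*-identityˡ p)))) ,
     *-identityʳ (b ^ k))

  monomial : ℕ → Polynomial
  monomial zero    = 1# List.∷ List.[]
  monomial (suc n) = 0# List.∷ monomial n

  ⟦monomial⟧ : ∀ n t → ⟦ monomial n ⟧ t ≈ t ^ n
  ⟦monomial⟧ zero    t = trans (+-congˡ (zeroʳ t)) (+-identityʳ 1#)
  ⟦monomial⟧ (suc n) t = trans (+-identityˡ _) (*-congˡ (⟦monomial⟧ n t))

  -- The factor k of the exponent is absorbed by the real power, being at most p; the constant n
  -- becomes the degree of the monomial.
  size-bound : ∀ d .{{_ : NonZero d}} {p} (0≤p : 0# ≤ p) k → fromℕ k ≤ p → ∀ n {m} → m ℕ.≤ d ℕ.^ (k ℕ.* n) →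
    fromℕ m ≤ ⟦ monomial n ⟧ (power (fromℕ d) p (1≤fromℕ d) 0≤p)
  size-bound d {p} 0≤p k k≤p n {m} m≤ = begin
    fromℕ m                      ≤⟨ fromℕ-mono m≤ ⟩
    fromℕ (d ℕ.^ (k ℕ.* n))      ≈⟨ fromℕ-^ d (k ℕ.* n) ⟩
    fromℕ d ^ (k ℕ.* n)          ≈⟨ ^-assocʳ (fromℕ d) k n ⟨
    (fromℕ d ^ k) ^ n            ≤⟨ ^-monoˡ-≤ n (^-nonNeg k (0≤fromℕ d)) (^≤power (1≤fromℕ d) 0≤p k k≤p) ⟩
    power (fromℕ d) p (1≤fromℕ d) 0≤p ^ n  ≈⟨ ⟦monomial⟧ n _ ⟨
    ⟦ monomial n ⟧ (power (fromℕ d) p (1≤fromℕ d) 0≤p) ∎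

  -- The left side is T² + 3T + 1 ≤ T² + 4T, and 4T ≤ T²ε. This is where the constant 4 comes from.
  scale-error : ∀ T .{{_ : NonZero T}} {ε} → fromℕ 4 ≤ fromℕ T * ε →
    fromℕ (suc T) * fromℕ (suc T) + fromℕ T ≤ (fromℕ T * fromℕ T) * (1# + ε)
  scale-error T {ε} 4≤Tε = begin
    fromℕ (suc T) * fromℕ (suc T) + t
      ≈⟨ trans (×-homo-+ 1# (suc T ℕ.* suc T) T) (+-congʳ (×1-homo-* (suc T) (suc T))) ⟨
    fromℕ (suc T ℕ.* suc T ℕ.+ T)       ≤⟨ fromℕ-mono [1+T]²+T≤T²+4T ⟩
    fromℕ (T ℕ.* T ℕ.+ T ℕ.* 4)
      ≈⟨ trans (×-homo-+ 1# (T ℕ.* T) (T ℕ.* 4)) (+-cong (×1-homo-* T T) (×1-homo-* T 4)) ⟩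
    t * t + t * fromℕ 4                 ≤⟨ +-mono-≤ ≤-refl (*-monoʳ-≤ (0≤fromℕ T) 4≤Tε) ⟩
    t * t + t * (t * ε)                 ≈⟨ +-cong (sym (*-identityʳ _)) (sym (*-assoc t t ε)) ⟩
    (t * t) * 1# + (t * t) * ε          ≈⟨ distribˡ (t * t) 1# ε ⟨
    (t * t) * (1# + ε)                  ∎
    where
    t = fromℕ T
    [1+T]²+T≤T²+4T : suc T ℕ.* suc T ℕ.+ T ℕ.≤ T ℕ.* T ℕ.+ T ℕ.* 4
    [1+T]²+T≤T²+4T = ℕ.≤-trans (ℕ.+-monoˡ-≤ _ (ℕ.>-nonZero⁻¹ T)) (ℕ.≤-reflexive (regroup T))
      where
      regroup : ∀ T → T ℕ.+ (T ℕ.+ T ℕ.* suc T ℕ.+ T) ≡ T ℕ.* T ℕ.+ T ℕ.* 4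
      regroup = solve-∀

  portfolio-of-size : ∀ {n} {D : Pred (Vector ℝ (suc n)) 0ℓ} → D ⊆ NonNegOrthant →
    (∀ f → IsSymmetricMonotonicNorm f → AttainsMinimum f D) →
    ∀ T .{{_ : NonZero T}} {ε} → fromℕ 4 ≤ fromℕ T * ε → ∀ l → suc n ℕ.≤ 2 ℕ.^ l →
    ∃ λ X → IsPortfolio (1# + ε) IsSymmetricMonotonicNorm D (_∈ₗ X) ×
            length X ℕ.≤ 2 ℕ.^ ((l ℕ.* T ℕ.+ 1) ℕ.+ ((2 ℕ.* l) ℕ.* T ℕ.+ T))
  portfolio-of-size D⊆ℝ≥0 attains T 4≤Tε l d≤2^l =
    let X , ∣X∣≤ , X⊆D , approx = grid-portfolio D⊆ℝ≥0 attains T l d≤2^l in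
    X , portfolio attains X⊆D (λ {f} fNorm {x} x∈D x-min →
      let x′ , x′∈X , close = approx fNorm x∈D x-min in
      x′ , x′∈X , *-cancelˡ-≤ 0<TT (≤-trans close (≤-trans
        (*-mono-≤ 0≤qq+t (IsSymmetricMonotonicNorm.nonNeg fNorm x) (scale-error T 4≤Tε) ≤-refl)
        (≤-reflexive (*-assoc _ _ _))))) , ∣X∣≤
    where
    0<TT : 0# < fromℕ T * fromℕ T
    0<TT = *-nonNeg (0≤fromℕ T) (0≤fromℕ T) , λ 0≈TT →
      proj₂ (0<fromℕ (T ℕ.* T) {{ℕ.m*n≢0 T T}}) (trans 0≈TT (sym (×1-homo-* T T)))

    0≤qq+t : 0# ≤ fromℕ (suc T) * fromℕ (suc T) + fromℕ T
    0≤qq+t = ≤-trans (≤-reflexive (sym (+-identityˡ 0#)))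
      (+-mono-≤ (*-nonNeg (0≤fromℕ (suc T)) (0≤fromℕ (suc T))) (0≤fromℕ T))

  polynomial-portfolio : ∀ d .{{_ : NonZero d}} (ε : ℝ) (0<ε : 0# < ε) → ε ≤ 1# →
    (D : Pred (Vector ℝ d) 0ℓ) → D ⊆ NonNegOrthant → Satisfiable D →
    (∀ f → IsSymmetricMonotonicNorm f → AttainsMinimum f D) →
    ∃ λ (X : List (Vector ℝ d)) →
      IsPortfolio (1# + ε) IsSymmetricMonotonicNorm D (_∈ₗ X) ×
      fromℕ (length X) ≤ ⟦ monomial 64 ⟧ (power (fromℕ d) (recip 0<ε) (1≤fromℕ d) (recip-nonNeg 0<ε))
  polynomial-portfolio zero {{()}}
  polynomial-portfolio (suc zero) ε 0<ε ε≤1 D D⊆ℝ≥0 _ attains =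
    let k , 1+k≤r , _ = floor (1≤recip 0<ε ε≤1)
        X , ∣X∣≡1 , X⊆D , approx = singleton-portfolio D⊆ℝ≥0 attains in
    X , portfolio attains X⊆D (λ {f} fNorm {x} x∈D _ →
      let x′ , x′∈X , fx′≤fx = approx fNorm x∈D in
      x′ , x′∈X , ≤-trans fx′≤fx (≤-trans (≤-reflexive (trans (*-congʳ (+-identityʳ 1#)) (*-identityˡ (f x))))
        (x≤[1+ε]x (proj₁ 0<ε) (IsSymmetricMonotonicNorm.nonNeg fNorm x)))) ,
    size-bound 1 (recip-nonNeg 0<ε) (suc k) 1+k≤r 64
      (ℕ.≤-reflexive (≡.trans ∣X∣≡1 (≡.sym (ℕ.^-zeroˡ (suc k ℕ.* 64)))))
  polynomial-portfolio d@(suc n@(suc _)) ε 0<ε ε≤1 D D⊆ℝ≥0 _ attains =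
    let l , d≤2^l , 2^l≤2d         = ∃-2^-between n
        X , X-isPortfolio , ∣X∣≤ = portfolio-of-size D⊆ℝ≥0 attains T 4≤Tε l d≤2^l in
    X , X-isPortfolio ,
    size-bound d (recip-nonNeg 0<ε) (suc k) 1+k≤r 64
      (ℕ.≤-trans ∣X∣≤ (path-count d T k l (s≤s (s≤s z≤n)) T≤8+8k (s≤s z≤n) 2^l≤2d))
    where
    k     = proj₁ (floor (1≤recip 0<ε ε≤1))
    1+k≤r = proj₁ (proj₂ (floor (1≤recip 0<ε ε≤1)))
    r≤2+k = proj₂ (proj₂ (floor (1≤recip 0<ε ε≤1)))

    T : ℕ
    -- As `2 + k` is at least 1/ε, `T` is at least 4/ε; as `suc k` is at most 1/ε, `T` is at most
    -- 8/ε.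
    T = 4 ℕ.* (2 ℕ.+ k)

    4≤Tε : fromℕ 4 ≤ fromℕ T * ε
    4≤Tε = begin
      fromℕ 4                          ≈⟨ *-identityʳ _ ⟨
      fromℕ 4 * 1#                     ≈⟨ *-congˡ (recip-inverse 0<ε) ⟨
      fromℕ 4 * (ε * recip 0<ε)        ≤⟨ *-monoʳ-≤ (0≤fromℕ 4) (*-monoʳ-≤ (proj₁ 0<ε) r≤2+k) ⟩
      fromℕ 4 * (ε * fromℕ (2 ℕ.+ k))  ≈⟨ *-congˡ (*-comm _ _) ⟩
      fromℕ 4 * (fromℕ (2 ℕ.+ k) * ε)  ≈⟨ *-assoc _ _ _ ⟨
      (fromℕ 4 * fromℕ (2 ℕ.+ k)) * ε  ≈⟨ *-congʳ (×1-homo-* 4 (2 ℕ.+ k)) ⟨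
      fromℕ T * ε                      ∎

    T≤8+8k : T ℕ.≤ 8 ℕ.* suc k
    T≤8+8k = ℕ.≤-trans (ℕ.m≤m+n T (4 ℕ.* k)) (ℕ.≤-reflexive (regroup k))
      where
      regroup : ∀ k → 4 ℕ.* (2 ℕ.+ k) ℕ.+ 4 ℕ.* k ≡ 8 ℕ.* suc k
      regroup = solve-∀

lemma4 : (em : ExcludedMiddle 0ℓ) (R : CompleteOrderedField) →
  let open CompleteOrderedField R renaming (Carrier to ℝ)
      open Real em R
  in ∃ λ (p : Polynomial) →
     ∀ (d : ℕ) .{{_ : NonZero d}} (ε : ℝ) (0<ε : 0# < ε) → ε ≤ 1# →
     (D : Pred (Vector ℝ d) 0ℓ) → D ⊆ NonNegOrthant → Satisfiable D →
     (∀ f → IsSymmetricMonotonicNorm f → AttainsMinimum f D) →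
     ∃ λ (X : List (Vector ℝ d)) →
       IsPortfolio (1# + ε) IsSymmetricMonotonicNorm D (_∈ₗ X) ×
       fromℕ (length X) ≤ ⟦ p ⟧ (power (fromℕ d) (recip 0<ε) (1≤fromℕ d) (recip-nonNeg 0<ε))
-- 64 is 8 * 8: the path count is at most d ^ (8 * T), and `T` is at most 8 * suc k.
lemma4 em R = monomial em R 64 , polynomial-portfolio em R
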